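{- The theories $\mathsf{RCA}_0^-$ and $\Delta\mathsf{RA}_2$ are equivalent (i.e. they have the same theorems in $L_2$).
   Context: **Language $L_1$ and BASIC.** $L_1$ is the first-order language with constant $0$, unary function symbols $S,H,T$, binary function symbols $+,\cdot$, a binary pairing function symbol $(\cdot,\cdot)$, and a binary relation $<$. Write $1=S(0)$, $2=S(S(0))$, and $x\le y$ for $x<y\lor x=y$. Pairing associates to the right, and $f(x,y)$ means $f((x,y))$. BASIC consists of the universal closures of: $S(x)\neq 0$; $S(x)=S(y)\to x=y$; $x+0=x$; $x+S(y)=S(x+y)$; $x\cdot 0=0$; $x\cdot S(y)=x\cdot y+x$; $\lnot x<0$; $x<S(y)\leftrightarrow x<y\lor x=y$; $x<y\lor x=y\lor y<x$; $0<x\to\exists y<x\,S(y)=x$; $(x,y)=z\leftrightarrow 2\cdot z=(x+y)\cdot(x+y+1)+2\cdot x+2$; $(x,y)=(x',y')\to x=x'\land y=y'$; $z>0\to\exists x,y<z\,(x,y)=z$; $H((x,y))=x$; $H(0)=0$; $T((x,y))=y$; $T(0)=0$. **$L_2$ and functions as sets.** $L_2$ is the two-sorted language extending $L_1$ with set variables and atomic formulas $t\in X$. $\Delta^0_0$ formulas are the $L_2$-formulas all of whose quantifiers are bounded number quantifiers (free set variables allowed). For a set $f$, $f\in\mathcal F$ abbreviates $\forall x\exists y\,(x,y)\in f\land\forall x,y,y'((x,y)\in f\land(x,y')\in f\to y=y')\land 0\notin f$; $f(t)=s$ abbreviates $(t,s)\in f$. **$\mathsf{RCA}_0^-$.** It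 consists of BASIC; the induction axiom (universal closure of $0\in X\land\forall x(x\in X\to S(x)\in X)\to x\in X$); $\Delta^0_0$ comprehension (universal closures of $\exists X\forall x(x\in X\leftrightarrow\varphi(x))$, $\varphi\in\Delta^0_0$, $X$ not free in $\varphi$, other parameters allowed); and the axiom $\circ$: $\forall g,h\in\mathcal F\,\exists f\in\mathcal F\;f:=g\circ h$. **Operators of $\Delta$.** Each is the universal closure over number variables of the displayed formula: - $f:=\mathrm S$: $f(x)=S(x)$; - $f:=\oplus$: $f(x,y)=x+y\land f(0)=0$; - $f:=\otimes$: $f(x,y)=x\cdot y\land f(0)=0$; - $f:={<_\ast}$: $(x<y\to f(x,y)=1)\land(x\ge y\to f(x,y)=0)\land f(0)=0$; - $f:=\mathrm I$: $f(x)=x$; - $f:=\mathrm D$: $f(0,y,z)=y\land f(S(x),y,z)=z\land f(0)=0\land f(x,0)=0$; - $f:=\mathrm P(g,h)$: $g(x)=v\land h(x)=w\to f(x)=(v,w)$; - $f:=g\circ h$: $h(x)=z\land g(z)=y\to f(x)=y$; - $f:=\mu(g)$: $(f(b,x)=z\to z\le b)\land(f(b,x)=z\land y<b\land g(y,x)=1\to z\le y)\land(f(b,x)=z\land z<b\to g(z,x)=1)\land f(0)=0$. **$\Delta\mathsf{RA}_2$.** The $L_2$-theory axiomatized by BASIC; for each operator $\mathrm{op}$ in the list above, $\forall g_1,\dots,g_n\in\mathcal F\,\exists f\in\mathcal F\;f:=\mathrm{op}(g_1,\dots,g_n)$ (with $n$ the number of arguments of the operator, possibly $0$); the oracle axiom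 $\forall X\exists f\in\mathcal F\,\forall x((x\in X\to f(x)=1)\land(x\notin X\to f(x)=0))$; and function comprehension $\forall p\,\forall f\in\mathcal F\,\exists X\,\forall x(x\in X\leftrightarrow f(x,p)=1)$. -}

module Defs where

open import Data.Nat using (ℕ; zero; suc; _+_)
open import Data.Fin using (Fin; zero; suc)
open import Data.Vec using (Vec; []; _∷_; reverse; map; allFin)
open import Data.List as List using (List; []; _∷_)
open import Data.List.Membership.Propositional using () renaming (_∈_ to _∈ᴸ_)
open import Function using (id; _∘_)
open import Function.Bundles using (_⇔_)

------------------------------------------------------------------------
-- Syntax of L₁ and L₂

infixl 9 _·_
infixl 8 _⊕_
infix  6 _≐_ _<̇_ _≤̇_ _∈̇_ _∉̇_ _[_]≐_
infix  7 ¬̇_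
infixr 4 _∧̇_
infixr 3 _∨̇_
infixr 2 _⇒̇_
infix  1 _⇔̇_

data Term (n : ℕ) : Set where
  var   : Fin n → Term n
  O     : Term n
  S H T : Term n → Term n
  _⊕_   : Term n → Term n → Term n
  _·_   : Term n → Term n → Term n
  ⟨_,_⟩ : Term n → Term n → Term n

-- Formula n k: n free number variables and k free set variables, as two
-- independent families of de Bruijn indices.  Only numbers have an equality
-- predicate, and variables are the only terms of the set sort.
data Formula (n k : ℕ) : Set where
  _≐_ _<̇_     : Term n → Term n → Formula n k
  _∈̇_         : Term n → Fin k → Formula n k
  ⊥̇           : Formula n k
  _∧̇_ _∨̇_ _⇒̇_ : Formula n k → Formula n k → Formula n k
  ∀₁ ∃₁       : Formula (suc n) k → Formula n k
  ∀₂ ∃₂       : Formula n (suc k) → Formula n k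

Sentence : Set
Sentence = Formula 0 0

pattern v₀ = var zero
pattern v₁ = var (suc zero)
pattern v₂ = var (suc (suc zero))
pattern v₃ = var (suc (suc (suc zero)))

pattern s₀ = zero
pattern s₁ = suc zero

private variable
  n n′ k k′ m : ℕ

𝟏 𝟐 : Term n
𝟏 = S O
𝟐 = S (S O)

¬̇_ : Formula n k → Formula n k
¬̇ φ = φ ⇒̇ ⊥̇

⊤̇ : Formula n k
⊤̇ = ¬̇ ⊥̇

_⇔̇_ : Formula n k → Formula n k → Formula n k
φ ⇔̇ ψ = (φ ⇒̇ ψ) ∧̇ (ψ ⇒̇ φ)

_≤̇_ : Term n → Term n → Formula n k
s ≤̇ t = s <̇ t ∨̇ s ≐ t

_∉̇_ : Term n → Fin k → Formula n k
t ∉̇ X = ¬̇ (t ∈̇ X)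

------------------------------------------------------------------------
-- Simultaneous substitution of terms for number variables and of set
-- variables for set variables

tsub : (Fin n → Term n′) → Term n → Term n′
tsub σ (var i)   = σ i
tsub σ O         = O
tsub σ (S t)     = S (tsub σ t)
tsub σ (H t)     = H (tsub σ t)
tsub σ (T t)     = T (tsub σ t)
tsub σ (s ⊕ t)   = tsub σ s ⊕ tsub σ t
tsub σ (s · t)   = tsub σ s · tsub σ t
tsub σ ⟨ s , t ⟩ = ⟨ tsub σ s , tsub σ t ⟩

twk : Term n → Term (suc n)
twk = tsub (var ∘ suc)

lift₁ : (Fin n → Term n′) → Fin (suc n) → Term (suc n′)
lift₁ σ zero    = v₀
lift₁ σ (suc i) = twk (σ i)

lift₂ : (Fin k → Fin k′) → Fin (suc k) → Fin (suc k′)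
lift₂ ρ zero    = zero
lift₂ ρ (suc i) = suc (ρ i)

sub : (Fin n → Term n′) → (Fin k → Fin k′) → Formula n k → Formula n′ k′
sub σ ρ (s ≐ t)  = tsub σ s ≐ tsub σ t
sub σ ρ (s <̇ t)  = tsub σ s <̇ tsub σ t
sub σ ρ (t ∈̇ X)  = tsub σ t ∈̇ ρ X
sub σ ρ ⊥̇        = ⊥̇
sub σ ρ (φ ∧̇ ψ)  = sub σ ρ φ ∧̇ sub σ ρ ψ
sub σ ρ (φ ∨̇ ψ)  = sub σ ρ φ ∨̇ sub σ ρ ψ
sub σ ρ (φ ⇒̇ ψ)  = sub σ ρ φ ⇒̇ sub σ ρ ψ
sub σ ρ (∀₁ φ)   = ∀₁ (sub (lift₁ σ) ρ φ)
sub σ ρ (∃₁ φ)   = ∃₁ (sub (lift₁ σ) ρ φ)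
sub σ ρ (∀₂ φ)   = ∀₂ (sub σ (lift₂ ρ) φ)
sub σ ρ (∃₂ φ)   = ∃₂ (sub σ (lift₂ ρ) φ)

wk₁ : Formula n k → Formula (suc n) k
wk₁ = sub (var ∘ suc) id

wk₂ : Formula n k → Formula n (suc k)
wk₂ = sub var suc

wkSentence : Sentence → Formula n k
wkSentence = sub (λ ()) (λ ())

inst₁ : Term n → Fin (suc n) → Term n
inst₁ t zero    = t
inst₁ t (suc i) = var i

inst₂ : Fin k → Fin (suc k) → Fin k
inst₂ X zero    = X
inst₂ X (suc i) = i

_[_]₁ : Formula (suc n) k → Term n → Formula n k
φ [ t ]₁ = sub (inst₁ t) id φ

_[_]₂ : Formula n (suc k) → Fin k → Formula n k
φ [ X ]₂ = sub var (inst₂ X) φ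

------------------------------------------------------------------------
-- Theories and classical two-sorted natural deduction

Theory : Set₁
Theory = Sentence → Set

infix 0 _∣_⊢_ _⊢_

data _∣_⊢_ (𝒯 : Theory) {n k : ℕ} (Γ : List (Formula n k)) :
           Formula n k → Set where
  ax   : ∀ {ψ} → 𝒯 ψ → 𝒯 ∣ Γ ⊢ wkSentence ψ
  hyp  : ∀ {φ} → φ ∈ᴸ Γ → 𝒯 ∣ Γ ⊢ φ
  raa  : ∀ {φ} → 𝒯 ∣ ¬̇ φ ∷ Γ ⊢ ⊥̇ → 𝒯 ∣ Γ ⊢ φ
  ∧I   : ∀ {φ ψ} → 𝒯 ∣ Γ ⊢ φ → 𝒯 ∣ Γ ⊢ ψ → 𝒯 ∣ Γ ⊢ φ ∧̇ ψ
  ∧E₁  : ∀ {φ ψ} → 𝒯 ∣ Γ ⊢ φ ∧̇ ψ → 𝒯 ∣ Γ ⊢ φ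
  ∧E₂  : ∀ {φ ψ} → 𝒯 ∣ Γ ⊢ φ ∧̇ ψ → 𝒯 ∣ Γ ⊢ ψ
  ∨I₁  : ∀ {φ ψ} → 𝒯 ∣ Γ ⊢ φ → 𝒯 ∣ Γ ⊢ φ ∨̇ ψ
  ∨I₂  : ∀ {φ ψ} → 𝒯 ∣ Γ ⊢ ψ → 𝒯 ∣ Γ ⊢ φ ∨̇ ψ
  ∨E   : ∀ {φ ψ χ} → 𝒯 ∣ Γ ⊢ φ ∨̇ ψ → 𝒯 ∣ φ ∷ Γ ⊢ χ → 𝒯 ∣ ψ ∷ Γ ⊢ χ → 𝒯 ∣ Γ ⊢ χ
  ⇒I   : ∀ {φ ψ} → 𝒯 ∣ φ ∷ Γ ⊢ ψ → 𝒯 ∣ Γ ⊢ φ ⇒̇ ψ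
  ⇒E   : ∀ {φ ψ} → 𝒯 ∣ Γ ⊢ φ ⇒̇ ψ → 𝒯 ∣ Γ ⊢ φ → 𝒯 ∣ Γ ⊢ ψ
  ∀₁I  : ∀ {φ} → 𝒯 ∣ List.map wk₁ Γ ⊢ φ → 𝒯 ∣ Γ ⊢ ∀₁ φ
  ∀₁E  : ∀ {φ} → 𝒯 ∣ Γ ⊢ ∀₁ φ → ∀ t → 𝒯 ∣ Γ ⊢ φ [ t ]₁
  ∃₁I  : ∀ {φ} t → 𝒯 ∣ Γ ⊢ φ [ t ]₁ → 𝒯 ∣ Γ ⊢ ∃₁ φ
  ∃₁E  : ∀ {φ χ} → 𝒯 ∣ Γ ⊢ ∃₁ φ → 𝒯 ∣ φ ∷ List.map wk₁ Γ ⊢ wk₁ χ → 𝒯 ∣ Γ ⊢ χ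
  ∀₂I  : ∀ {φ} → 𝒯 ∣ List.map wk₂ Γ ⊢ φ → 𝒯 ∣ Γ ⊢ ∀₂ φ
  ∀₂E  : ∀ {φ} → 𝒯 ∣ Γ ⊢ ∀₂ φ → ∀ X → 𝒯 ∣ Γ ⊢ φ [ X ]₂
  ∃₂I  : ∀ {φ} X → 𝒯 ∣ Γ ⊢ φ [ X ]₂ → 𝒯 ∣ Γ ⊢ ∃₂ φ
  ∃₂E  : ∀ {φ χ} → 𝒯 ∣ Γ ⊢ ∃₂ φ → 𝒯 ∣ φ ∷ List.map wk₂ Γ ⊢ wk₂ χ → 𝒯 ∣ Γ ⊢ χ
  -- Standard first-order logic has nonempty domains; for scoped contexts
  -- without free set variables this needs its own rule (for numbers, O serves).
  ∃set : 𝒯 ∣ Γ ⊢ ∃₂ ⊤̇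
  ≐I   : ∀ {t} → 𝒯 ∣ Γ ⊢ t ≐ t
  ≐E   : ∀ (φ : Formula (suc n) k) {s t} →
         𝒯 ∣ Γ ⊢ s ≐ t → 𝒯 ∣ Γ ⊢ φ [ s ]₁ → 𝒯 ∣ Γ ⊢ φ [ t ]₁

_⊢_ : Theory → Formula n k → Set
𝒯 ⊢ φ = 𝒯 ∣ [] ⊢ φ

-- The formulas may have free variables; sentences are the case n = k = 0.
Equivalent : Theory → Theory → Set
Equivalent 𝒯 𝒰 = ∀ {n k} (φ : Formula n k) → (𝒯 ⊢ φ) ⇔ (𝒰 ⊢ φ)

------------------------------------------------------------------------
-- Closures, bounded quantifiers, functions as sets

close : ∀ n k → Formula n k → Sentence
close zero    zero    φ = φ
close zero    (suc k) φ = close zero k (∀₂ φ)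
close (suc n) k       φ = close n k (∀₁ φ)

∀₁^ : ∀ m → Formula (m + n) k → Formula n k
∀₁^ zero    φ = φ
∀₁^ (suc m) φ = ∀₁^ m (∀₁ φ)

-- The bound is weakened, so the quantified variable does not occur in it.
∀< ∃< : Term n → Formula (suc n) k → Formula n k
∀< t φ = ∀₁ (v₀ <̇ twk t ⇒̇ φ)
∃< t φ = ∃₁ (v₀ <̇ twk t ∧̇ φ)

data Δ⁰₀ {n k : ℕ} : Formula n k → Set where
  ≐Δ : ∀ {s t} → Δ⁰₀ (s ≐ t)
  <Δ : ∀ {s t} → Δ⁰₀ (s <̇ t)
  ∈Δ : ∀ {t X} → Δ⁰₀ (t ∈̇ X)
  ⊥Δ : Δ⁰₀ ⊥̇
  ∧Δ : ∀ {φ ψ} → Δ⁰₀ φ → Δ⁰₀ ψ → Δ⁰₀ (φ ∧̇ ψ)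
  ∨Δ : ∀ {φ ψ} → Δ⁰₀ φ → Δ⁰₀ ψ → Δ⁰₀ (φ ∨̇ ψ)
  ⇒Δ : ∀ {φ ψ} → Δ⁰₀ φ → Δ⁰₀ ψ → Δ⁰₀ (φ ⇒̇ ψ)
  ∀Δ : ∀ {t φ} → Δ⁰₀ φ → Δ⁰₀ (∀< t φ)
  ∃Δ : ∀ {t φ} → Δ⁰₀ φ → Δ⁰₀ (∃< t φ)

-- f [ t ]≐ s is "f(t) = s"
_[_]≐_ : Fin k → Term n → Term n → Formula n k
f [ t ]≐ s = ⟨ t , s ⟩ ∈̇ f

_∈ℱ : Fin k → Formula n k
f ∈ℱ = ∀₁ (∃₁ (⟨ v₁ , v₀ ⟩ ∈̇ f))
    ∧̇ ∀₁^ 3 (⟨ v₀ , v₁ ⟩ ∈̇ f ∧̇ ⟨ v₀ , v₂ ⟩ ∈̇ f ⇒̇ v₁ ≐ v₂)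
    ∧̇ O ∉̇ f

∀ℱ ∃ℱ : Formula n (suc k) → Formula n k
∀ℱ φ = ∀₂ (s₀ ∈ℱ ⇒̇ φ)
∃ℱ φ = ∃₂ (s₀ ∈ℱ ∧̇ φ)

∀ℱ^ : ∀ m → Formula n m → Formula n 0
∀ℱ^ zero    φ = φ
∀ℱ^ (suc m) φ = ∀ℱ^ m (∀ℱ φ)

------------------------------------------------------------------------
-- BASIC

-- Under close n 0, the variables v₀, v₁, v₂, v₃ are x, y, z, … (or x, y, x′, y′).
data BASIC : Theory where
  S≠0    : BASIC (close 1 0 (¬̇ (S v₀ ≐ O)))
  S-inj  : BASIC (close 2 0 (S v₀ ≐ S v₁ ⇒̇ v₀ ≐ v₁))
  +0     : BASIC (close 1 0 (v₀ ⊕ O ≐ v₀))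
  +S     : BASIC (close 2 0 (v₀ ⊕ S v₁ ≐ S (v₀ ⊕ v₁)))
  ·0     : BASIC (close 1 0 (v₀ · O ≐ O))
  ·S     : BASIC (close 2 0 (v₀ · S v₁ ≐ v₀ · v₁ ⊕ v₀))
  ≮0     : BASIC (close 1 0 (¬̇ (v₀ <̇ O)))
  <S     : BASIC (close 2 0 (v₀ <̇ S v₁ ⇔̇ (v₀ <̇ v₁ ∨̇ v₀ ≐ v₁)))
  <-tri  : BASIC (close 2 0 (v₀ <̇ v₁ ∨̇ v₀ ≐ v₁ ∨̇ v₁ <̇ v₀))
  pred   : BASIC (close 1 0 (O <̇ v₀ ⇒̇ ∃< v₀ (S v₀ ≐ v₁)))
  pair   : BASIC (close 3 0
             (⟨ v₀ , v₁ ⟩ ≐ v₂ ⇔̇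
              𝟐 · v₂ ≐ (v₀ ⊕ v₁) · (v₀ ⊕ v₁ ⊕ 𝟏) ⊕ 𝟐 · v₀ ⊕ 𝟐))
  pair-inj : BASIC (close 4 0
               (⟨ v₀ , v₁ ⟩ ≐ ⟨ v₂ , v₃ ⟩ ⇒̇ v₀ ≐ v₂ ∧̇ v₁ ≐ v₃))
  pair-sur : BASIC (close 1 0
               (O <̇ v₀ ⇒̇ ∃< v₀ (∃< v₁ (⟨ v₁ , v₀ ⟩ ≐ v₂))))
  H-pair : BASIC (close 2 0 (H ⟨ v₀ , v₁ ⟩ ≐ v₀))
  H0     : BASIC (H O ≐ O)
  T-pair : BASIC (close 2 0 (T ⟨ v₀ , v₁ ⟩ ≐ v₁))
  T0     : BASIC (T O ≐ O)

------------------------------------------------------------------------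
-- The operators of Δ

data Op : ℕ → Set where
  Sᵒ ⊕ᵒ ⊗ᵒ <ᵒ Iᵒ Dᵒ : Op 0
  μᵒ                : Op 1
  Pᵒ ∘ᵒ             : Op 2

-- f ≔ op gs.  In each clause v₀ is x; the other variables are y, z in this
-- order, except v, w for Pᵒ and y, z, b for μᵒ.
infix 6 _≔_∙_
_≔_∙_ : Fin k → Op m → Vec (Fin k) m → Formula n k
f ≔ Sᵒ ∙ [] = ∀₁^ 1 (f [ v₀ ]≐ S v₀)
f ≔ ⊕ᵒ ∙ [] = ∀₁^ 2 (f [ ⟨ v₀ , v₁ ⟩ ]≐ v₀ ⊕ v₁ ∧̇ f [ O ]≐ O)
f ≔ ⊗ᵒ ∙ [] = ∀₁^ 2 (f [ ⟨ v₀ , v₁ ⟩ ]≐ v₀ · v₁ ∧̇ f [ O ]≐ O)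
f ≔ <ᵒ ∙ [] = ∀₁^ 2 ((v₀ <̇ v₁ ⇒̇ f [ ⟨ v₀ , v₁ ⟩ ]≐ 𝟏)
                  ∧̇ (v₁ ≤̇ v₀ ⇒̇ f [ ⟨ v₀ , v₁ ⟩ ]≐ O)
                  ∧̇ f [ O ]≐ O)
f ≔ Iᵒ ∙ [] = ∀₁^ 1 (f [ v₀ ]≐ v₀)
f ≔ Dᵒ ∙ [] = ∀₁^ 3 (f [ ⟨ O , ⟨ v₁ , v₂ ⟩ ⟩ ]≐ v₁
                  ∧̇ f [ ⟨ S v₀ , ⟨ v₁ , v₂ ⟩ ⟩ ]≐ v₂
                  ∧̇ f [ O ]≐ O
                  ∧̇ f [ ⟨ v₀ , O ⟩ ]≐ O)
f ≔ Pᵒ ∙ (g ∷ h ∷ []) =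
  ∀₁^ 3 (g [ v₀ ]≐ v₁ ∧̇ h [ v₀ ]≐ v₂ ⇒̇ f [ v₀ ]≐ ⟨ v₁ , v₂ ⟩)
f ≔ ∘ᵒ ∙ (g ∷ h ∷ []) =
  ∀₁^ 3 (h [ v₀ ]≐ v₂ ∧̇ g [ v₂ ]≐ v₁ ⇒̇ f [ v₀ ]≐ v₁)
f ≔ μᵒ ∙ (g ∷ []) =
  ∀₁^ 4 ((f [ ⟨ v₃ , v₀ ⟩ ]≐ v₂ ⇒̇ v₂ ≤̇ v₃)
      ∧̇ (f [ ⟨ v₃ , v₀ ⟩ ]≐ v₂ ∧̇ v₁ <̇ v₃ ∧̇ g [ ⟨ v₁ , v₀ ⟩ ]≐ 𝟏 ⇒̇ v₂ ≤̇ v₁)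
      ∧̇ (f [ ⟨ v₃ , v₀ ⟩ ]≐ v₂ ∧̇ v₂ <̇ v₃ ⇒̇ g [ ⟨ v₂ , v₀ ⟩ ]≐ 𝟏)
      ∧̇ f [ O ]≐ O)

-- ∀ g₁, …, gₘ ∈ ℱ  ∃ f ∈ ℱ  f ≔ op g₁ … gₘ.  Below the quantifiers f is s₀
-- and gₘ, …, g₁ are the successive indices 1, …, m.
opAxiom : Op m → Sentence
opAxiom {m} op = ∀ℱ^ m (∃ℱ (s₀ ≔ op ∙ reverse (map suc (allFin m))))

------------------------------------------------------------------------
-- The two theories

data RCA₀⁻ : Theory where
  basic         : ∀ {φ} → BASIC φ → RCA₀⁻ φ
  induction     : RCA₀⁻ (close 0 1
                    (O ∈̇ s₀ ∧̇ ∀₁ (v₀ ∈̇ s₀ ⇒̇ S v₀ ∈̇ s₀) ⇒̇ ∀₁ (v₀ ∈̇ s₀)))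
  -- φ has the comprehension variable v₀ and n number and k set parameters.
  comprehension : ∀ {n k} {φ : Formula (suc n) k} → Δ⁰₀ φ →
                  RCA₀⁻ (close n k (∃₂ (∀₁ (v₀ ∈̇ s₀ ⇔̇ wk₂ φ))))
  composition   : RCA₀⁻ (opAxiom ∘ᵒ)

data ΔRA₂ : Theory where
  basic         : ∀ {φ} → BASIC φ → ΔRA₂ φ
  operator      : ∀ {m} (op : Op m) → ΔRA₂ (opAxiom op)
  oracle        : ΔRA₂ (∀₂ (∃ℱ (∀₁ ((v₀ ∈̇ s₁ ⇒̇ s₀ [ v₀ ]≐ 𝟏)
                                 ∧̇ (v₀ ∉̇ s₁ ⇒̇ s₀ [ v₀ ]≐ O)))))
  comprehension : ΔRA₂ (∀₁ (∀ℱ (∃₂ (∀₁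
                    (v₀ ∈̇ s₀ ⇔̇ s₁ [ ⟨ v₀ , v₁ ⟩ ]≐ 𝟏)))))

{-# OPTIONS --safe #-}
module Submission where

-- The theories are equivalent because each derives the axioms of the other; derivations
-- are then translated axiom by axiom (⊢-theory).
--
-- RCA₀⁻ derives the axioms of ΔRA₂.  Composition is an axiom of RCA₀⁻.  Every other
-- operator yields a function whose graph is defined by a Δ⁰₀ formula φ(x, y).  A number
-- w ≠ 0 is the pair (H w, T w), so comprehension gives the set of all w ≠ 0 with
-- φ(H w, T w), and this set is a function as soon as φ is provably total and single-valued
-- (function-with-graph).  For bounded minimisation, totality is a Δ⁰₀ induction on the
-- bound (min-exists), which reduces to induction for the set that comprehension supplies.
--
-- ΔRA₂ derives the axioms of RCA₀⁻.  Code x₁, …, xₙ by c = (x₁, (x₂, … (xₙ, 0))).  By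
-- recursion, every term has a function in ℱ that computes its value from c, and every Δ⁰₀
-- formula has a characteristic function in ℱ on codes (rep).  The projections H and T are
-- D(0, _) and D(1, _).  From characteristic functions f of θ and g of η, the function
-- g(c) < f(c) is one of θ ∧ ¬ η, which generates all connectives.  If f is a characteristic
-- function of θ(z, c), then ∃ z < t θ(z, c) holds just when the minimum μ(f)(t, c) is below t.
-- Function comprehension with the code of the parameters is then Δ⁰₀ comprehension.
--
-- All this precedes induction, so facts about < that are proved by induction cannot enter.
-- Asymmetry of < is enough, and it holds because < has a characteristic function in ℱ
-- (<-asym).  Induction for X follows: if a ∉ X, then bounded minimisation finds z ≤ a that
-- is least outside X; z is not 0, and its predecessor is in X, so z is in X as well
-- (set-induction).
--
-- Quantifier-free steps of these derivations are found by a proof search that returns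
-- derivations (auto); it is given the instances of lemmas and hypotheses to be used.

open import Defs
open import Data.Bool using (Bool; true; false; if_then_else_; _∨_) renaming (T to IsTrue)
open import Data.Fin using (Fin; zero; suc)
open import Data.List as List using (List; []; _∷_; _++_)
open import Data.List.Membership.Propositional using () renaming (_∈_ to _∈ᴸ_)
open import Data.List.Membership.Propositional.Properties using (∈-map⁺; ∈-map⁻)
open import Data.List.Relation.Unary.Any using (here; there)
open import Data.Maybe as Maybe using (Maybe; just; nothing; is-just; _<∣>_)
open import Data.Nat using (ℕ; zero; suc; _+_; _<ᵇ_)
open import Data.Product using (Σ; ∃; _×_; _,_; proj₁)
open import Data.Vec using (Vec; []; _∷_; lookup)
open import Function using (id; _∘_)
open import Function.Bundles using (mk⇔)
open import Relation.Binary.PropositionalEquality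
  using (_≡_; _≗_; refl; sym; trans; cong; cong₂; subst)

private variable
  m n n′ n″ k k′ k″ : ℕ
  σ τ : Fin n → Term n′
  ρ π : Fin k → Fin k′
  𝒯 𝒰 : Theory

pattern i₀ = here refl
pattern i₁ = there i₀
pattern i₂ = there i₁
pattern i₃ = there i₂
pattern i₄ = there i₃
pattern i₅ = there i₄

-- Substitution

tsub-cong : σ ≗ τ → ∀ t → tsub σ t ≡ tsub τ t
tsub-cong e (var i)   = e i
tsub-cong e O         = refl
tsub-cong e (S t)     = cong S (tsub-cong e t)
tsub-cong e (H t)     = cong H (tsub-cong e t)
tsub-cong e (T t)     = cong T (tsub-cong e t)
tsub-cong e (s ⊕ t)   = cong₂ _⊕_ (tsub-cong e s) (tsub-cong e t)
tsub-cong e (s · t)   = cong₂ _·_ (tsub-cong e s) (tsub-cong e t)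
tsub-cong e ⟨ s , t ⟩ = cong₂ ⟨_,_⟩ (tsub-cong e s) (tsub-cong e t)

tsub-tsub : (τ : Fin n′ → Term n″) (σ : Fin n → Term n′) →
            ∀ t → tsub τ (tsub σ t) ≡ tsub (tsub τ ∘ σ) t
tsub-tsub τ σ (var i)   = refl
tsub-tsub τ σ O         = refl
tsub-tsub τ σ (S t)     = cong S (tsub-tsub τ σ t)
tsub-tsub τ σ (H t)     = cong H (tsub-tsub τ σ t)
tsub-tsub τ σ (T t)     = cong T (tsub-tsub τ σ t)
tsub-tsub τ σ (s ⊕ t)   = cong₂ _⊕_ (tsub-tsub τ σ s) (tsub-tsub τ σ t)
tsub-tsub τ σ (s · t)   = cong₂ _·_ (tsub-tsub τ σ s) (tsub-tsub τ σ t)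
tsub-tsub τ σ ⟨ s , t ⟩ = cong₂ ⟨_,_⟩ (tsub-tsub τ σ s) (tsub-tsub τ σ t)

tsub-id : (∀ i → σ i ≡ var i) → ∀ t → tsub σ t ≡ t
tsub-id e (var i)   = e i
tsub-id e O         = refl
tsub-id e (S t)     = cong S (tsub-id e t)
tsub-id e (H t)     = cong H (tsub-id e t)
tsub-id e (T t)     = cong T (tsub-id e t)
tsub-id e (s ⊕ t)   = cong₂ _⊕_ (tsub-id e s) (tsub-id e t)
tsub-id e (s · t)   = cong₂ _·_ (tsub-id e s) (tsub-id e t)
tsub-id e ⟨ s , t ⟩ = cong₂ ⟨_,_⟩ (tsub-id e s) (tsub-id e t)

lift₁-cong : σ ≗ τ → lift₁ σ ≗ lift₁ τ
lift₁-cong e zero    = refl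
lift₁-cong e (suc i) = cong twk (e i)

lift₂-cong : ρ ≗ π → lift₂ ρ ≗ lift₂ π
lift₂-cong e zero    = refl
lift₂-cong e (suc i) = cong suc (e i)

lift₁-id : (∀ i → σ i ≡ var i) → ∀ i → lift₁ σ i ≡ var i
lift₁-id e zero    = refl
lift₁-id e (suc i) = cong twk (e i)

lift₂-id : (∀ i → ρ i ≡ i) → ∀ i → lift₂ ρ i ≡ i
lift₂-id e zero    = refl
lift₂-id e (suc i) = cong suc (e i)

twk-tsub : (σ : Fin n → Term n′) → ∀ t → tsub (lift₁ σ) (twk t) ≡ twk (tsub σ t)
twk-tsub σ t = trans (tsub-tsub (lift₁ σ) (var ∘ suc) t) (sym (tsub-tsub (var ∘ suc) σ t))

inst-twk : ∀ (s t : Term n) → tsub (inst₁ s) (twk t) ≡ t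
inst-twk s t = trans (tsub-tsub (inst₁ s) (var ∘ suc) t) (tsub-id (λ _ → refl) t)

lift₁-∘ : (τ : Fin n′ → Term n″) (σ : Fin n → Term n′) →
          tsub (lift₁ τ) ∘ lift₁ σ ≗ lift₁ (tsub τ ∘ σ)
lift₁-∘ τ σ zero    = refl
lift₁-∘ τ σ (suc i) = twk-tsub τ (σ i)

lift₂-∘ : (π : Fin k′ → Fin k″) (ρ : Fin k → Fin k′) → lift₂ π ∘ lift₂ ρ ≗ lift₂ (π ∘ ρ)
lift₂-∘ π ρ zero    = refl
lift₂-∘ π ρ (suc i) = refl

sub-cong : σ ≗ τ → ρ ≗ π → (φ : Formula n k) → sub {n} {n′} {k} {k′} σ ρ φ ≡ sub τ π φ
sub-cong e f (s ≐ t)  = cong₂ _≐_ (tsub-cong e s) (tsub-cong e t)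
sub-cong e f (s <̇ t)  = cong₂ _<̇_ (tsub-cong e s) (tsub-cong e t)
sub-cong e f (t ∈̇ X)  = cong₂ _∈̇_ (tsub-cong e t) (f X)
sub-cong e f ⊥̇        = refl
sub-cong e f (φ ∧̇ ψ)  = cong₂ _∧̇_ (sub-cong e f φ) (sub-cong e f ψ)
sub-cong e f (φ ∨̇ ψ)  = cong₂ _∨̇_ (sub-cong e f φ) (sub-cong e f ψ)
sub-cong e f (φ ⇒̇ ψ)  = cong₂ _⇒̇_ (sub-cong e f φ) (sub-cong e f ψ)
sub-cong e f (∀₁ φ)   = cong ∀₁ (sub-cong (lift₁-cong e) f φ)
sub-cong e f (∃₁ φ)   = cong ∃₁ (sub-cong (lift₁-cong e) f φ)
sub-cong e f (∀₂ φ)   = cong ∀₂ (sub-cong e (lift₂-cong f) φ)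
sub-cong e f (∃₂ φ)   = cong ∃₂ (sub-cong e (lift₂-cong f) φ)

sub-id : (∀ i → σ i ≡ var i) → (∀ j → ρ j ≡ j) → (φ : Formula n k) → sub σ ρ φ ≡ φ
sub-id e f (s ≐ t)  = cong₂ _≐_ (tsub-id e s) (tsub-id e t)
sub-id e f (s <̇ t)  = cong₂ _<̇_ (tsub-id e s) (tsub-id e t)
sub-id e f (t ∈̇ X)  = cong₂ _∈̇_ (tsub-id e t) (f X)
sub-id e f ⊥̇        = refl
sub-id e f (φ ∧̇ ψ)  = cong₂ _∧̇_ (sub-id e f φ) (sub-id e f ψ)
sub-id e f (φ ∨̇ ψ)  = cong₂ _∨̇_ (sub-id e f φ) (sub-id e f ψ)
sub-id e f (φ ⇒̇ ψ)  = cong₂ _⇒̇_ (sub-id e f φ) (sub-id e f ψ)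
sub-id e f (∀₁ φ)   = cong ∀₁ (sub-id (lift₁-id e) f φ)
sub-id e f (∃₁ φ)   = cong ∃₁ (sub-id (lift₁-id e) f φ)
sub-id e f (∀₂ φ)   = cong ∀₂ (sub-id e (lift₂-id f) φ)
sub-id e f (∃₂ φ)   = cong ∃₂ (sub-id e (lift₂-id f) φ)

sub-sub : (τ : Fin n′ → Term n″) (π : Fin k′ → Fin k″)
          (σ : Fin n → Term n′) (ρ : Fin k → Fin k′) (φ : Formula n k) →
          sub τ π (sub σ ρ φ) ≡ sub (tsub τ ∘ σ) (π ∘ ρ) φ
sub-sub τ π σ ρ (s ≐ t)  = cong₂ _≐_ (tsub-tsub τ σ s) (tsub-tsub τ σ t)
sub-sub τ π σ ρ (s <̇ t)  = cong₂ _<̇_ (tsub-tsub τ σ s) (tsub-tsub τ σ t)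
sub-sub τ π σ ρ (t ∈̇ X)  = cong (_∈̇ π (ρ X)) (tsub-tsub τ σ t)
sub-sub τ π σ ρ ⊥̇        = refl
sub-sub τ π σ ρ (φ ∧̇ ψ)  = cong₂ _∧̇_ (sub-sub τ π σ ρ φ) (sub-sub τ π σ ρ ψ)
sub-sub τ π σ ρ (φ ∨̇ ψ)  = cong₂ _∨̇_ (sub-sub τ π σ ρ φ) (sub-sub τ π σ ρ ψ)
sub-sub τ π σ ρ (φ ⇒̇ ψ)  = cong₂ _⇒̇_ (sub-sub τ π σ ρ φ) (sub-sub τ π σ ρ ψ)
sub-sub τ π σ ρ (∀₁ φ)   = cong ∀₁ (trans (sub-sub (lift₁ τ) π (lift₁ σ) ρ φ)
                                          (sub-cong (lift₁-∘ τ σ) (λ _ → refl) φ))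
sub-sub τ π σ ρ (∃₁ φ)   = cong ∃₁ (trans (sub-sub (lift₁ τ) π (lift₁ σ) ρ φ)
                                          (sub-cong (lift₁-∘ τ σ) (λ _ → refl) φ))
sub-sub τ π σ ρ (∀₂ φ)   = cong ∀₂ (trans (sub-sub τ (lift₂ π) σ (lift₂ ρ) φ)
                                          (sub-cong (λ _ → refl) (lift₂-∘ π ρ) φ))
sub-sub τ π σ ρ (∃₂ φ)   = cong ∃₂ (trans (sub-sub τ (lift₂ π) σ (lift₂ ρ) φ)
                                          (sub-cong (λ _ → refl) (lift₂-∘ π ρ) φ))

sub-square : ∀ {n₁ n₂ k₁ k₂}
  {τ : Fin n₁ → Term n′} {π : Fin k₁ → Fin k′} {σ : Fin n → Term n₁} {ρ : Fin k → Fin k₁}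
  {τ′ : Fin n₂ → Term n′} {π′ : Fin k₂ → Fin k′} {σ′ : Fin n → Term n₂} {ρ′ : Fin k → Fin k₂} →
  tsub τ ∘ σ ≗ tsub τ′ ∘ σ′ → π ∘ ρ ≗ π′ ∘ ρ′ → (φ : Formula n k) →
  sub τ π (sub σ ρ φ) ≡ sub τ′ π′ (sub σ′ ρ′ φ)
sub-square e f φ = trans (sub-sub _ _ _ _ φ) (trans (sub-cong e f φ) (sym (sub-sub _ _ _ _ φ)))

sub-fuse : ∀ {n₁ k₁} {τ : Fin n₁ → Term n′} {π : Fin k₁ → Fin k′} {σ : Fin n → Term n₁}
  {ρ : Fin k → Fin k₁} {σ′ : Fin n → Term n′} {ρ′ : Fin k → Fin k′} →
  tsub τ ∘ σ ≗ σ′ → π ∘ ρ ≗ ρ′ → (φ : Formula n k) → sub τ π (sub σ ρ φ) ≡ sub σ′ ρ′ φ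
sub-fuse e f φ = trans (sub-sub _ _ _ _ φ) (sub-cong e f φ)

-- Derivations under substitution

cast : ∀ {Γ : List (Formula n k)} {φ ψ} → φ ≡ ψ → 𝒯 ∣ Γ ⊢ φ → 𝒯 ∣ Γ ⊢ ψ
cast = subst (_ ∣ _ ⊢_)

module _ (σ : Fin n → Term n′) (ρ : Fin k → Fin k′) where

  sub-wk₁ : ∀ φ → sub (lift₁ σ) ρ (wk₁ φ) ≡ wk₁ (sub σ ρ φ)
  sub-wk₁ = sub-square (λ _ → refl) (λ _ → refl)

  sub-wk₂ : ∀ φ → sub σ (lift₂ ρ) (wk₂ φ) ≡ wk₂ (sub σ ρ φ)
  sub-wk₂ = sub-square (λ i → sym (tsub-id (λ _ → refl) (σ i))) (λ _ → refl)

  sub-[]₁ : ∀ φ t → sub σ ρ (φ [ t ]₁) ≡ sub (lift₁ σ) ρ φ [ tsub σ t ]₁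
  sub-[]₁ φ t = sub-square (λ { zero → refl ; (suc i) → sym (inst-twk (tsub σ t) (σ i)) })
                           (λ _ → refl) φ

  sub-[]₂ : ∀ φ X → sub σ ρ (φ [ X ]₂) ≡ sub σ (lift₂ ρ) φ [ ρ X ]₂
  sub-[]₂ φ X = sub-square (λ i → sym (tsub-id (λ _ → refl) (σ i)))
                           (λ { zero → refl ; (suc i) → refl }) φ

-- Simultaneous weakening and substitution of contexts, so that a single recursion over
-- derivations yields both structural weakening and substitution.
infix 4 _↪⟨_,_⟩_
_↪⟨_,_⟩_ : List (Formula n k) → (Fin n → Term n′) → (Fin k → Fin k′) → List (Formula n′ k′) → Set
Γ ↪⟨ σ , ρ ⟩ Γ′ = ∀ {φ} → φ ∈ᴸ Γ → sub σ ρ φ ∈ᴸ Γ′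

module _ {σ : Fin n → Term n′} {ρ : Fin k → Fin k′}
         {Γ : List (Formula n k)} {Γ′ : List (Formula n′ k′)} where

  ↪-∷ : ∀ {φ} → Γ ↪⟨ σ , ρ ⟩ Γ′ → φ ∷ Γ ↪⟨ σ , ρ ⟩ sub σ ρ φ ∷ Γ′
  ↪-∷ s i₀ = here refl
  ↪-∷ s (there i)   = there (s i)

  ↪-wk₁ : Γ ↪⟨ σ , ρ ⟩ Γ′ → List.map wk₁ Γ ↪⟨ lift₁ σ , ρ ⟩ List.map wk₁ Γ′
  ↪-wk₁ s i with ∈-map⁻ wk₁ i
  ... | φ , j , refl = subst (_∈ᴸ _) (sym (sub-wk₁ σ ρ φ)) (∈-map⁺ wk₁ (s j))

  ↪-wk₂ : Γ ↪⟨ σ , ρ ⟩ Γ′ → List.map wk₂ Γ ↪⟨ σ , lift₂ ρ ⟩ List.map wk₂ Γ′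
  ↪-wk₂ s i with ∈-map⁻ wk₂ i
  ... | φ , j , refl = subst (_∈ᴸ _) (sym (sub-wk₂ σ ρ φ)) (∈-map⁺ wk₂ (s j))

⊢-sub : {Γ : List (Formula n k)} {Γ′ : List (Formula n′ k′)}
        (σ : Fin n → Term n′) (ρ : Fin k → Fin k′) → Γ ↪⟨ σ , ρ ⟩ Γ′ →
        ∀ {φ} → 𝒯 ∣ Γ ⊢ φ → 𝒯 ∣ Γ′ ⊢ sub σ ρ φ
⊢-sub σ ρ s (ax {ψ} a)        = cast (sym (sub-fuse (λ ()) (λ ()) ψ)) (ax a)
⊢-sub σ ρ s (hyp i)           = hyp (s i)
⊢-sub σ ρ s (raa d)           = raa (⊢-sub σ ρ (↪-∷ s) d)
⊢-sub σ ρ s (∧I d e)          = ∧I (⊢-sub σ ρ s d) (⊢-sub σ ρ s e)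
⊢-sub σ ρ s (∧E₁ d)           = ∧E₁ (⊢-sub σ ρ s d)
⊢-sub σ ρ s (∧E₂ d)           = ∧E₂ (⊢-sub σ ρ s d)
⊢-sub σ ρ s (∨I₁ d)           = ∨I₁ (⊢-sub σ ρ s d)
⊢-sub σ ρ s (∨I₂ d)           = ∨I₂ (⊢-sub σ ρ s d)
⊢-sub σ ρ s (∨E d e f)        = ∨E (⊢-sub σ ρ s d) (⊢-sub σ ρ (↪-∷ s) e) (⊢-sub σ ρ (↪-∷ s) f)
⊢-sub σ ρ s (⇒I d)            = ⇒I (⊢-sub σ ρ (↪-∷ s) d)
⊢-sub σ ρ s (⇒E d e)          = ⇒E (⊢-sub σ ρ s d) (⊢-sub σ ρ s e)
⊢-sub σ ρ s (∀₁I d)           = ∀₁I (⊢-sub (lift₁ σ) ρ (↪-wk₁ s) d)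
⊢-sub σ ρ s (∀₁E {φ} d t)     = cast (sym (sub-[]₁ σ ρ φ t)) (∀₁E (⊢-sub σ ρ s d) (tsub σ t))
⊢-sub σ ρ s (∃₁I {φ} t d)     = ∃₁I (tsub σ t) (cast (sub-[]₁ σ ρ φ t) (⊢-sub σ ρ s d))
⊢-sub σ ρ s (∃₁E {φ} {χ} d e) =
  ∃₁E (⊢-sub σ ρ s d) (cast (sub-wk₁ σ ρ χ) (⊢-sub (lift₁ σ) ρ (↪-∷ (↪-wk₁ s)) e))
⊢-sub σ ρ s (∀₂I d)           = ∀₂I (⊢-sub σ (lift₂ ρ) (↪-wk₂ s) d)
⊢-sub σ ρ s (∀₂E {φ} d X)     = cast (sym (sub-[]₂ σ ρ φ X)) (∀₂E (⊢-sub σ ρ s d) (ρ X))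
⊢-sub σ ρ s (∃₂I {φ} X d)     = ∃₂I (ρ X) (cast (sub-[]₂ σ ρ φ X) (⊢-sub σ ρ s d))
⊢-sub σ ρ s (∃₂E {φ} {χ} d e) =
  ∃₂E (⊢-sub σ ρ s d) (cast (sub-wk₂ σ ρ χ) (⊢-sub σ (lift₂ ρ) (↪-∷ (↪-wk₂ s)) e))
⊢-sub σ ρ s ∃set              = ∃set
⊢-sub σ ρ s ≐I                = ≐I
⊢-sub σ ρ s (≐E φ {u} {v} d e) =
  cast (sym (sub-[]₁ σ ρ φ v))
       (≐E (sub (lift₁ σ) ρ φ) (⊢-sub σ ρ s d) (cast (sub-[]₁ σ ρ φ u) (⊢-sub σ ρ s e)))

module _ {Γ : List (Formula n k)} {φ : Formula n k} where

  weaken : {Γ′ : List (Formula n k)} → (∀ {ψ} → ψ ∈ᴸ Γ → ψ ∈ᴸ Γ′) → 𝒯 ∣ Γ ⊢ φ → 𝒯 ∣ Γ′ ⊢ φ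
  weaken s d = cast (sub-id (λ _ → refl) (λ _ → refl) φ)
    (⊢-sub var id (λ {ψ} i → subst (_∈ᴸ _) (sym (sub-id (λ _ → refl) (λ _ → refl) ψ)) (s i)) d)

  ⊢wk₁ : 𝒯 ∣ Γ ⊢ φ → 𝒯 ∣ List.map wk₁ Γ ⊢ wk₁ φ
  ⊢wk₁ = ⊢-sub (var ∘ suc) id (∈-map⁺ wk₁)

  ⊢wk₂ : 𝒯 ∣ Γ ⊢ φ → 𝒯 ∣ List.map wk₂ Γ ⊢ wk₂ φ
  ⊢wk₂ = ⊢-sub var suc (∈-map⁺ wk₂)

  cut : ∀ {χ} → 𝒯 ∣ Γ ⊢ φ → 𝒯 ∣ φ ∷ Γ ⊢ χ → 𝒯 ∣ Γ ⊢ χ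
  cut d e = ⇒E (⇒I e) d

inst : {φ : Formula n k} → 𝒯 ⊢ φ → {Γ : List (Formula n′ k′)} →
       (ts : Vec (Term n′) n) (Xs : Vec (Fin k′) k) → 𝒯 ∣ Γ ⊢ sub (lookup ts) (lookup Xs) φ
inst d ts Xs = ⊢-sub (lookup ts) (lookup Xs) (λ ()) d

∀-open : {Γ : List (Formula n k)} {φ : Formula (suc n) k} → 𝒯 ∣ Γ ⊢ ∀₁ φ → 𝒯 ∣ List.map wk₁ Γ ⊢ φ
∀-open {φ = φ} d =
  cast (trans (sub-fuse (λ { zero → refl ; (suc i) → refl }) (λ _ → refl) φ)
              (sub-id (λ _ → refl) (λ _ → refl) φ))
       (∀₁E (⊢wk₁ d) v₀)

∀₂-open : {Γ : List (Formula n k)} {φ : Formula n (suc k)} → 𝒯 ∣ Γ ⊢ ∀₂ φ → 𝒯 ∣ List.map wk₂ Γ ⊢ φ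
∀₂-open {φ = φ} d =
  cast (trans (sub-fuse (λ _ → refl) (λ { zero → refl ; (suc i) → refl }) φ)
              (sub-id (λ _ → refl) (λ _ → refl) φ))
       (∀₂E (⊢wk₂ d) zero)

close-⊢ : ∀ n k {φ : Formula n k} → 𝒯 ⊢ φ → 𝒯 ⊢ close n k φ
close-⊢ zero    zero    d = d
close-⊢ zero    (suc k) d = close-⊢ zero k (∀₂I d)
close-⊢ (suc n) k       d = close-⊢ n k (∀₁I d)

unclose : ∀ n k {φ : Formula n k} → 𝒯 ⊢ close n k φ → 𝒯 ⊢ φ
unclose zero    zero    d = d
unclose zero    (suc k) d = ∀₂-open (unclose zero k d)
unclose (suc n) k       d = ∀-open (unclose n k d)

-- Axioms are used with their outermost universal quantifiers removed.
axiom : ∀ n k {φ : Formula n k} → 𝒯 (close n k φ) → 𝒯 ⊢ φ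
axiom n k a = unclose n k (cast (sub-id (λ ()) (λ ()) _) (ax a))

⊢-theory : (∀ {ψ} → 𝒯 ψ → 𝒰 ⊢ ψ) → {Γ : List (Formula n k)} → ∀ {φ} → 𝒯 ∣ Γ ⊢ φ → 𝒰 ∣ Γ ⊢ φ
⊢-theory t (ax a)     = ⊢-sub (λ ()) (λ ()) (λ ()) (t a)
⊢-theory t (hyp i)    = hyp i
⊢-theory t (raa d)    = raa (⊢-theory t d)
⊢-theory t (∧I d e)   = ∧I (⊢-theory t d) (⊢-theory t e)
⊢-theory t (∧E₁ d)    = ∧E₁ (⊢-theory t d)
⊢-theory t (∧E₂ d)    = ∧E₂ (⊢-theory t d)
⊢-theory t (∨I₁ d)    = ∨I₁ (⊢-theory t d)
⊢-theory t (∨I₂ d)    = ∨I₂ (⊢-theory t d)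
⊢-theory t (∨E d e f) = ∨E (⊢-theory t d) (⊢-theory t e) (⊢-theory t f)
⊢-theory t (⇒I d)     = ⇒I (⊢-theory t d)
⊢-theory t (⇒E d e)   = ⇒E (⊢-theory t d) (⊢-theory t e)
⊢-theory t (∀₁I d)    = ∀₁I (⊢-theory t d)
⊢-theory t (∀₁E d u)  = ∀₁E (⊢-theory t d) u
⊢-theory t (∃₁I u d)  = ∃₁I u (⊢-theory t d)
⊢-theory t (∃₁E d e)  = ∃₁E (⊢-theory t d) (⊢-theory t e)
⊢-theory t (∀₂I d)    = ∀₂I (⊢-theory t d)
⊢-theory t (∀₂E d X)  = ∀₂E (⊢-theory t d) X
⊢-theory t (∃₂I X d)  = ∃₂I X (⊢-theory t d)
⊢-theory t (∃₂E d e)  = ∃₂E (⊢-theory t d) (⊢-theory t e)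
⊢-theory t ∃set       = ∃set
⊢-theory t ≐I         = ≐I
⊢-theory t (≐E φ d e) = ≐E φ (⊢-theory t d) (⊢-theory t e)

-- Proof search

infix 4 _≟ᶠ_ _≟ᵗ_ _≟_

_≟ᶠ_ : (i j : Fin n) → Maybe (i ≡ j)
zero  ≟ᶠ zero  = just refl
suc i ≟ᶠ suc j = Maybe.map (cong suc) (i ≟ᶠ j)
_     ≟ᶠ _     = nothing

_≟ᵗ_ : (s t : Term n) → Maybe (s ≡ t)
var i     ≟ᵗ var j       = Maybe.map (cong var) (i ≟ᶠ j)
O         ≟ᵗ O           = just refl
S s       ≟ᵗ S t         = Maybe.map (cong S) (s ≟ᵗ t)
H s       ≟ᵗ H t         = Maybe.map (cong H) (s ≟ᵗ t)
T s       ≟ᵗ T t         = Maybe.map (cong T) (s ≟ᵗ t)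
s ⊕ t     ≟ᵗ s′ ⊕ t′     = Maybe.zipWith (cong₂ _⊕_) (s ≟ᵗ s′) (t ≟ᵗ t′)
s · t     ≟ᵗ s′ · t′     = Maybe.zipWith (cong₂ _·_) (s ≟ᵗ s′) (t ≟ᵗ t′)
⟨ s , t ⟩ ≟ᵗ ⟨ s′ , t′ ⟩ = Maybe.zipWith (cong₂ ⟨_,_⟩) (s ≟ᵗ s′) (t ≟ᵗ t′)
_         ≟ᵗ _           = nothing

_≟_ : (φ ψ : Formula n k) → Maybe (φ ≡ ψ)
(s ≐ t)  ≟ (s′ ≐ t′) = Maybe.zipWith (cong₂ _≐_) (s ≟ᵗ s′) (t ≟ᵗ t′)
(s <̇ t)  ≟ (s′ <̇ t′) = Maybe.zipWith (cong₂ _<̇_) (s ≟ᵗ s′) (t ≟ᵗ t′)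
(t ∈̇ X)  ≟ (t′ ∈̇ X′) = Maybe.zipWith (cong₂ _∈̇_) (t ≟ᵗ t′) (X ≟ᶠ X′)
⊥̇        ≟ ⊥̇         = just refl
(φ ∧̇ ψ)  ≟ (φ′ ∧̇ ψ′) = Maybe.zipWith (cong₂ _∧̇_) (φ ≟ φ′) (ψ ≟ ψ′)
(φ ∨̇ ψ)  ≟ (φ′ ∨̇ ψ′) = Maybe.zipWith (cong₂ _∨̇_) (φ ≟ φ′) (ψ ≟ ψ′)
(φ ⇒̇ ψ)  ≟ (φ′ ⇒̇ ψ′) = Maybe.zipWith (cong₂ _⇒̇_) (φ ≟ φ′) (ψ ≟ ψ′)
∀₁ φ     ≟ ∀₁ ψ      = Maybe.map (cong ∀₁) (φ ≟ ψ)
∃₁ φ     ≟ ∃₁ ψ      = Maybe.map (cong ∃₁) (φ ≟ ψ)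
∀₂ φ     ≟ ∀₂ ψ      = Maybe.map (cong ∀₂) (φ ≟ ψ)
∃₂ φ     ≟ ∃₂ ψ      = Maybe.map (cong ∃₂) (φ ≟ ψ)
_        ≟ _         = nothing

-- The measure that orients equations.  The oriented equation cannot have its left side
-- inside its right side, so rewriting with it removes the left side for good.
size : Term n → ℕ
size (var i)   = 1
size O         = 0
size (S t)     = suc (size t)
size (H t)     = 2 + size t
size (T t)     = 2 + size t
size (s ⊕ t)   = 2 + size s + size t
size (s · t)   = 2 + size s + size t
size ⟨ s , t ⟩ = 2 + size s + size t

occursᵗ : Term n → Term n → Bool
occursᵗ s u = is-just (s ≟ᵗ u) ∨ below u
  where
  below : Term _ → Bool
  below (var i)   = false
  below O         = false
  below (S t)     = occursᵗ s t
  below (H t)     = occursᵗ s t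
  below (T t)     = occursᵗ s t
  below (t ⊕ u)   = occursᵗ s t ∨ occursᵗ s u
  below (t · u)   = occursᵗ s t ∨ occursᵗ s u
  below ⟨ t , u ⟩ = occursᵗ s t ∨ occursᵗ s u

-- Rewriting treats quantified subformulas as atoms.
occurs : Term n → Formula n k → Bool
occurs s (t ≐ u) = occursᵗ s t ∨ occursᵗ s u
occurs s (t <̇ u) = occursᵗ s t ∨ occursᵗ s u
occurs s (t ∈̇ X) = occursᵗ s t
occurs s (φ ∧̇ ψ) = occurs s φ ∨ occurs s ψ
occurs s (φ ∨̇ ψ) = occurs s φ ∨ occurs s ψ
occurs s (φ ⇒̇ ψ) = occurs s φ ∨ occurs s ψ
occurs s _       = false

module _ (s : Term n) where

  -- The ways to see t as an instance at s; abstractᵗ replaces every occurrence of s, so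
  -- that the equality rule rewrites all of them at once.
  Abstractᵗ : Term n → Set
  Abstractᵗ t = Σ (Term (suc n)) λ t′ → tsub (inst₁ s) t′ ≡ t

  Abstract : Formula n k → Set
  Abstract {k} φ = Σ (Formula (suc n) k) λ φ′ → φ′ [ s ]₁ ≡ φ

  abstractᵗ : ∀ t → Abstractᵗ t
  abstractᵗ t with s ≟ᵗ t
  abstractᵗ t         | just e  = v₀ , e
  abstractᵗ (var i)   | nothing = var (suc i) , refl
  abstractᵗ O         | nothing = O , refl
  abstractᵗ (S t)     | nothing with abstractᵗ t
  ... | t′ , e = S t′ , cong S e
  abstractᵗ (H t)     | nothing with abstractᵗ t
  ... | t′ , e = H t′ , cong H e
  abstractᵗ (T t)     | nothing with abstractᵗ t
  ... | t′ , e = T t′ , cong T e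
  abstractᵗ (t ⊕ u)   | nothing with abstractᵗ t | abstractᵗ u
  ... | t′ , e | u′ , f = t′ ⊕ u′ , cong₂ _⊕_ e f
  abstractᵗ (t · u)   | nothing with abstractᵗ t | abstractᵗ u
  ... | t′ , e | u′ , f = t′ · u′ , cong₂ _·_ e f
  abstractᵗ ⟨ t , u ⟩ | nothing with abstractᵗ t | abstractᵗ u
  ... | t′ , e | u′ , f = ⟨ t′ , u′ ⟩ , cong₂ ⟨_,_⟩ e f

  opaque₁ : (φ : Formula n k) → Abstract φ
  opaque₁ φ = wk₁ φ , trans (sub-fuse (λ _ → refl) (λ _ → refl) φ) (sub-id (λ _ → refl) (λ _ → refl) φ)

  abstract₁ : (φ : Formula n k) → Abstract φ
  abstract₁ (t ≐ u) with abstractᵗ t | abstractᵗ u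
  ... | t′ , e | u′ , f = t′ ≐ u′ , cong₂ _≐_ e f
  abstract₁ (t <̇ u) with abstractᵗ t | abstractᵗ u
  ... | t′ , e | u′ , f = t′ <̇ u′ , cong₂ _<̇_ e f
  abstract₁ (t ∈̇ X) with abstractᵗ t
  ... | t′ , e = t′ ∈̇ X , cong (_∈̇ X) e
  abstract₁ (φ ∧̇ ψ) with abstract₁ φ | abstract₁ ψ
  ... | φ′ , e | ψ′ , f = (φ′ ∧̇ ψ′) , cong₂ _∧̇_ e f
  abstract₁ (φ ∨̇ ψ) with abstract₁ φ | abstract₁ ψ
  ... | φ′ , e | ψ′ , f = (φ′ ∨̇ ψ′) , cong₂ _∨̇_ e f
  abstract₁ (φ ⇒̇ ψ) with abstract₁ φ | abstract₁ ψ
  ... | φ′ , e | ψ′ , f = (φ′ ⇒̇ ψ′) , cong₂ _⇒̇_ e f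
  abstract₁ φ       = opaque₁ φ

module _ {𝒯 : Theory} where

  Fact : List (Formula n k) → Set
  Fact Γ = ∃ λ φ → 𝒯 ∣ Γ ⊢ φ

  infixr 5 _◂_
  _◂_ : ∀ {Γ : List (Formula n k)} {φ} → 𝒯 ∣ Γ ⊢ φ → List (Fact Γ) → List (Fact Γ)
  d ◂ fs = (_ , d) ∷ fs

  weakenFact : ∀ {Γ : List (Formula n k)} {ψ} → Fact Γ → Fact (ψ ∷ Γ)
  weakenFact (φ , d) = φ , weaken there d

  hyps : (Γ : List (Formula n k)) → List (Fact Γ)
  hyps []      = []
  hyps (φ ∷ Γ) = (φ , hyp i₀) ∷ List.map weakenFact (hyps Γ)

  exfalso : ∀ {Γ : List (Formula n k)} {φ} → 𝒯 ∣ Γ ⊢ ⊥̇ → 𝒯 ∣ Γ ⊢ φ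
  exfalso d = raa (weaken there d)

  ≐-sym : ∀ {Γ : List (Formula n k)} {s t} → 𝒯 ∣ Γ ⊢ s ≐ t → 𝒯 ∣ Γ ⊢ t ≐ s
  ≐-sym {s = s} {t} d =
    cast (cong (t ≐_) (inst-twk t s)) (≐E (v₀ ≐ twk s) d (cast (cong (s ≐_) (sym (inst-twk s s))) ≐I))

  module _ {Γ : List (Formula n k)} where

    record Rule : Set where
      constructor rule
      field
        {from to} : Term n
        equation  : 𝒯 ∣ Γ ⊢ from ≐ to

    open Rule

    orient : ∀ {s t} → 𝒯 ∣ Γ ⊢ s ≐ t → Rule
    orient {s} {t} d = if size s <ᵇ size t then rule (≐-sym d) else rule d

    rewriteBy : Rule → Fact Γ → Fact Γ
    rewriteBy r (φ , d) with abstract₁ (from r) φ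
    ... | φ′ , e = φ′ [ to r ]₁ , ≐E φ′ (equation r) (cast (sym e) d)

    normalise : ℕ → List Rule → Fact Γ → Fact Γ
    normalise zero    rs f = f
    normalise (suc m) rs f = go rs
      where
      go : List Rule → Fact Γ
      go []       = f
      go (r ∷ rs′) = if occurs (from r) (proj₁ f) then normalise m rs (rewriteBy r f) else go rs′

    lookupFact : (φ : Formula n k) → List (Fact Γ) → Maybe (𝒯 ∣ Γ ⊢ φ)
    lookupFact φ []             = nothing
    lookupFact φ ((ψ , d) ∷ fs) with ψ ≟ φ
    ... | just refl = just d
    ... | nothing   = lookupFact φ fs

    -- Evaluation of a formula whose truth value is already fixed by the known literals L.
    prove    : List (Fact Γ) → (φ : Formula n k) → Maybe (𝒯 ∣ Γ ⊢ φ)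
    disprove : List (Fact Γ) → (φ : Formula n k) → Maybe (𝒯 ∣ Γ ⊢ ¬̇ φ)

    prove L (s ≐ t) with s ≟ᵗ t
    ... | just refl = just ≐I
    ... | nothing   = nothing
    prove L (φ ∧̇ ψ) = Maybe.zipWith ∧I (prove L φ) (prove L ψ)
    prove L (φ ∨̇ ψ) = Maybe.map ∨I₁ (prove L φ) <∣> Maybe.map ∨I₂ (prove L ψ)
    prove L (φ ⇒̇ ψ) = Maybe.map (λ d → ⇒I (weaken there d)) (prove L ψ)
                  <∣> Maybe.map (λ d → ⇒I (exfalso (⇒E (weaken there d) (hyp i₀))))
                                (disprove L φ)
    prove L φ       = lookupFact φ L

    disprove L (s ≐ t) = lookupFact (¬̇ (s ≐ t)) L
                     <∣> Maybe.map (λ d → ⇒I (⇒E (weaken there d) (≐-sym (hyp i₀))))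
                                   (lookupFact (¬̇ (t ≐ s)) L)
    disprove L ⊥̇       = just (⇒I (hyp i₀))
    disprove L (φ ∧̇ ψ) =
      Maybe.map (λ d → ⇒I (⇒E (weaken there d) (∧E₁ (hyp i₀)))) (disprove L φ)
      <∣> Maybe.map (λ d → ⇒I (⇒E (weaken there d) (∧E₂ (hyp i₀)))) (disprove L ψ)
    disprove L (φ ∨̇ ψ) =
      Maybe.zipWith (λ d e → ⇒I (∨E (hyp i₀)
                                    (⇒E (weaken (there ∘ there) d) (hyp i₀))
                                    (⇒E (weaken (there ∘ there) e) (hyp i₀))))
                    (disprove L φ) (disprove L ψ)
    disprove L (φ ⇒̇ ψ) =
      Maybe.zipWith (λ d e → ⇒I (⇒E (weaken there e) (⇒E (hyp i₀) (weaken there d))))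
                    (prove L φ) (disprove L ψ)
    disprove L φ       = lookupFact (¬̇ φ) L

    -- The treatment of a fact, given the known literals; delay postpones a case distinction.
    data Step : Set where
      drop conflict literal delay : Step
      equality                    : Rule → Step
      add                         : List (Fact Γ) → Step

  record State (Γ : List (Formula n k)) : Set where
    constructor state
    field
      rules                 : List (Rule {Γ = Γ})
      literals delayed todo : List (Fact Γ)

  weakenState : ∀ {Γ : List (Formula n k)} {ψ} → State Γ → State (ψ ∷ Γ)
  weakenState (state rs L D Q) =
    state (List.map (λ r → rule (weaken there (Rule.equation r))) rs)
          (List.map weakenFact L) (List.map weakenFact D) (List.map weakenFact Q)

  -- Rules and literals that the new rule rewrites go back to the queue, as in completion:
  -- the rules stay interreduced and the literals stay in normal form.
  addRule : ∀ {Γ : List (Formula n k)} → Rule {Γ = Γ} → State Γ → State Γ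
  addRule r (state rs L D Q) = splitRules rs [] (splitFacts L [] (D ++ Q))
    where
    splitFacts : List (Fact _) → List (Fact _) → List (Fact _) → List (Fact _) × List (Fact _)
    splitFacts []      keep redo = keep , redo
    splitFacts (f ∷ L) keep redo =
      if occurs (Rule.from r) (proj₁ f) then splitFacts L keep (f ∷ redo)
                                        else splitFacts L (f ∷ keep) redo
    splitRules : List Rule → List Rule → List (Fact _) × List (Fact _) → State _
    splitRules []       keep (L , redo) = state (r ∷ keep) L [] redo
    splitRules (q ∷ rs) keep (L , redo) =
      if occursᵗ (Rule.from r) (Rule.from q) ∨ occursᵗ (Rule.from r) (Rule.to q)
      then splitRules rs keep (L , (_ , Rule.equation q) ∷ redo)
      else splitRules rs (q ∷ keep) (L , redo)

  -- Tableau search with unit propagation: a case distinction is made only when no fact is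
  -- left in the queue.  The first argument bounds the number of steps.
  refute : ℕ → ∀ {Γ : List (Formula n k)} → State Γ → Maybe (𝒯 ∣ Γ ⊢ ⊥̇)
  process : ℕ → ∀ {Γ : List (Formula n k)} → State Γ → Fact Γ → Maybe (𝒯 ∣ Γ ⊢ ⊥̇)

  refute zero    _                       = nothing
  refute (suc m) (state rs L D (f ∷ Q))  = process m (state rs L D Q) (normalise 100 rs f)
  refute (suc m) (state rs L [] [])      = nothing
  refute (suc m) (state rs L (f ∷ D) []) = branch f
    where
    st = state rs L [] D
    split : ∀ α {χ} → (𝒯 ∣ _ ⊢ ¬̇ α → 𝒯 ∣ _ ⊢ χ) → Maybe (𝒯 ∣ _ ⊢ ⊥̇)
    split α {χ} d = Maybe.zipWith (λ a b → ⇒E (⇒I b) (d (⇒I a)))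
      (process m (weakenState st) (α , hyp i₀))
      (process m (weakenState st) (χ , hyp i₀))
    branch : Fact _ → Maybe (𝒯 ∣ _ ⊢ ⊥̇)
    branch ((φ ∧̇ ψ ⇒̇ ⊥̇) , d) =
      split (¬̇ φ) {¬̇ ψ} λ a → ⇒I (⇒E (weaken there d)
        (∧I (raa (⇒E (weaken (there ∘ there) a) (hyp i₀))) (hyp i₀)))
    branch ((φ ⇒̇ ψ) , d) = split (¬̇ φ) {ψ} λ a →
      ⇒E d (raa (⇒E (weaken there a) (hyp i₀)))
    branch ((φ ∨̇ ψ) , d) = split φ {ψ} λ a →
      ∨E d (exfalso (⇒E (weaken there a) (hyp i₀))) (hyp i₀)
    branch _ = nothing

  process m {Γ} st@(state rs L D Q) (φ , d) = result (step φ d)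
    where
    -- Unit resolution for a fact that amounts to the disjunction of α and β.
    clause : ∀ α β → (𝒯 ∣ Γ ⊢ ¬̇ α → 𝒯 ∣ Γ ⊢ β) → (𝒯 ∣ Γ ⊢ ¬̇ β → 𝒯 ∣ Γ ⊢ α) → Step {Γ = Γ}
    clause α β f g with prove L α | prove L β | disprove L α | disprove L β
    ... | just _  | _       | _      | _      = drop
    ... | nothing | just _  | _      | _      = drop
    ... | nothing | nothing | just a | _      = add (f a ◂ [])
    ... | nothing | nothing | _      | just b = add (g b ◂ [])
    ... | nothing | nothing | nothing | nothing = delay
    lit : ∀ φ → Step {Γ = Γ}
    lit φ with prove L φ | disprove L φ
    ... | just _  | _       = drop
    ... | nothing | just _  = conflict
    ... | nothing | nothing = literal
    step : ∀ φ → 𝒯 ∣ Γ ⊢ φ → Step {Γ = Γ}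
    step (s ≐ t) d with s ≟ᵗ t
    ... | just _  = drop
    ... | nothing with disprove L (s ≐ t)
    ...   | just _  = conflict
    ...   | nothing = equality (orient d)
    step (φ ∧̇ ψ) d = add (∧E₁ d ◂ ∧E₂ d ◂ [])
    step (φ ∨̇ ψ) d = clause φ ψ
      (λ a → ∨E d (exfalso (⇒E (weaken there a) (hyp i₀))) (hyp i₀))
      (λ a → ∨E d (hyp i₀) (exfalso (⇒E (weaken there a) (hyp i₀))))
    step (⊥̇ ⇒̇ ⊥̇) d = drop
    step ((φ ⇒̇ ψ) ⇒̇ ⊥̇) d =
      add (raa (⇒E (weaken there d) (⇒I (exfalso (⇒E (hyp i₁) (hyp i₀)))))
           ◂ ⇒I (⇒E (weaken there d) (⇒I (hyp i₁))) ◂ [])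
    step (φ ∨̇ ψ ⇒̇ ⊥̇) d =
      add (⇒I (⇒E (weaken there d) (∨I₁ (hyp i₀)))
           ◂ ⇒I (⇒E (weaken there d) (∨I₂ (hyp i₀))) ◂ [])
    step (φ ∧̇ ψ ⇒̇ ⊥̇) d = clause (¬̇ φ) (¬̇ ψ)
      (λ a → ⇒I (⇒E (weaken there d) (∧I (raa (⇒E (weaken (there ∘ there) a) (hyp i₀)))
                                         (hyp i₀))))
      (λ b → ⇒I (⇒E (weaken there d) (∧I (hyp i₀)
                                         (raa (⇒E (weaken (there ∘ there) b) (hyp i₀))))))
    step (φ ⇒̇ ⊥̇) d = lit (¬̇ φ)
    step (φ ⇒̇ ψ) d = clause (¬̇ φ) ψ
      (λ a → ⇒E d (raa (⇒E (weaken there a) (hyp i₀))))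
      (λ b → ⇒I (⇒E (weaken there b) (⇒E (weaken there d) (hyp i₀))))
    step ⊥̇ d = conflict
    step φ d = lit φ
    contradiction : ∀ φ → 𝒯 ∣ Γ ⊢ φ → Maybe (𝒯 ∣ Γ ⊢ ⊥̇)
    contradiction ⊥̇ d       = just d
    contradiction (φ ⇒̇ ⊥̇) d = Maybe.map (⇒E d) (prove L φ)
    contradiction φ d       = Maybe.map (λ e → ⇒E e d) (disprove L φ)
    result : Step {Γ = Γ} → Maybe (𝒯 ∣ Γ ⊢ ⊥̇)
    result drop         = refute m st
    result conflict     = contradiction φ d
    result literal      = refute m (state rs ((φ , d) ∷ L) [] (D ++ Q))
    result (equality r) = refute m (addRule r st)
    result (add fs)     = refute m (state rs L D (fs ++ Q))
    result delay        = refute m (state rs L ((φ , d) ∷ D) Q)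

  search : ∀ {Γ : List (Formula n k)} φ → List (Fact Γ) → Maybe (𝒯 ∣ Γ ⊢ φ)
  search {Γ = Γ} φ fs = Maybe.map raa (refute 1000 (state [] [] []
    (hyps (¬̇ φ ∷ Γ) ++ List.map weakenFact fs)))

  -- The implicit argument is found by running the search during type checking.
  auto : ∀ {Γ : List (Formula n k)} {φ} (fs : List (Fact Γ)) → {IsTrue (is-just (search φ fs))} → 𝒯 ∣ Γ ⊢ φ
  auto {φ = φ} fs {p} with search φ fs
  ... | just d = d

-- Equality and quantifiers

-- In lemmas the numbers of free variables are explicit; the lemmas are used at terms and
-- sets by inst.
infix 0 _⊢[_,_]_
_⊢[_,_]_ : Theory → ∀ n k → Formula n k → Set
𝒯 ⊢[ n , k ] φ = 𝒯 ⊢ φ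

module _ {𝒯 : Theory} where

  ≐-trans : ∀ {Γ : List (Formula n k)} {s t u} → 𝒯 ∣ Γ ⊢ s ≐ t → 𝒯 ∣ Γ ⊢ t ≐ u → 𝒯 ∣ Γ ⊢ s ≐ u
  ≐-trans {s = s} {t} {u} d e = ⇒E (⇒E (inst lemma (s ∷ t ∷ u ∷ []) []) d) e
    where
    lemma : 𝒯 ⊢[ 3 , 0 ] v₀ ≐ v₁ ⇒̇ v₁ ≐ v₂ ⇒̇ v₀ ≐ v₂
    lemma = auto []

  module _ {Γ : List (Formula n k)} where

    tsub-≐ : {σ τ : Fin n′ → Term n} → (∀ i → 𝒯 ∣ Γ ⊢ σ i ≐ τ i) →
             ∀ t → 𝒯 ∣ Γ ⊢ tsub σ t ≐ tsub τ t
    tsub-≐ e (var i)   = e i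
    tsub-≐ e O         = ≐I
    tsub-≐ e (S t)     = ⇒E (inst cong-S (_ ∷ _ ∷ []) []) (tsub-≐ e t)
      where
      cong-S : 𝒯 ⊢[ 2 , 0 ] v₀ ≐ v₁ ⇒̇ S v₀ ≐ S v₁
      cong-S = auto []
    tsub-≐ e (H t)     = ⇒E (inst cong-H (_ ∷ _ ∷ []) []) (tsub-≐ e t)
      where
      cong-H : 𝒯 ⊢[ 2 , 0 ] v₀ ≐ v₁ ⇒̇ H v₀ ≐ H v₁
      cong-H = auto []
    tsub-≐ e (T t)     = ⇒E (inst cong-T (_ ∷ _ ∷ []) []) (tsub-≐ e t)
      where
      cong-T : 𝒯 ⊢[ 2 , 0 ] v₀ ≐ v₁ ⇒̇ T v₀ ≐ T v₁
      cong-T = auto []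
    tsub-≐ e (s ⊕ t)   = ⇒E (⇒E (inst cong-⊕ (_ ∷ _ ∷ _ ∷ _ ∷ []) []) (tsub-≐ e s)) (tsub-≐ e t)
      where
      cong-⊕ : 𝒯 ⊢[ 4 , 0 ] v₀ ≐ v₁ ⇒̇ v₂ ≐ v₃ ⇒̇ v₀ ⊕ v₂ ≐ v₁ ⊕ v₃
      cong-⊕ = auto []
    tsub-≐ e (s · t)   = ⇒E (⇒E (inst cong-· (_ ∷ _ ∷ _ ∷ _ ∷ []) []) (tsub-≐ e s)) (tsub-≐ e t)
      where
      cong-· : 𝒯 ⊢[ 4 , 0 ] v₀ ≐ v₁ ⇒̇ v₂ ≐ v₃ ⇒̇ v₀ · v₂ ≐ v₁ · v₃
      cong-· = auto []
    tsub-≐ e ⟨ s , t ⟩ = ⇒E (⇒E (inst cong-⟨⟩ (_ ∷ _ ∷ _ ∷ _ ∷ []) []) (tsub-≐ e s)) (tsub-≐ e t)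
      where
      cong-⟨⟩ : 𝒯 ⊢[ 4 , 0 ] v₀ ≐ v₁ ⇒̇ v₂ ≐ v₃ ⇒̇ ⟨ v₀ , v₂ ⟩ ≐ ⟨ v₁ , v₃ ⟩
      cong-⟨⟩ = auto []

  -- The goal of an elimination of an existential quantifier, when it is again existential,
  -- can have the eliminated variable as its witness.
  ∃₁-fresh : ∀ {Δ : List (Formula (suc n) k)} {ψ} → 𝒯 ∣ Δ ⊢ ψ → 𝒯 ∣ Δ ⊢ wk₁ (∃₁ ψ)
  ∃₁-fresh {ψ = ψ} d = ∃₁I v₀ (cast (sym (trans
    (sub-fuse (λ { zero → refl ; (suc i) → refl }) (λ _ → refl) ψ)
    (sub-id (λ _ → refl) (λ _ → refl) ψ))) d)

  ∃₂-fresh : ∀ {Δ : List (Formula n (suc k))} {ψ} → 𝒯 ∣ Δ ⊢ ψ → 𝒯 ∣ Δ ⊢ wk₂ (∃₂ ψ)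
  ∃₂-fresh {ψ = ψ} d = ∃₂I zero (cast (sym (trans
    (sub-fuse (λ _ → refl) (λ { zero → refl ; (suc i) → refl }) ψ)
    (sub-id (λ _ → refl) (λ _ → refl) ψ))) d)

  module _ {Γ : List (Formula n k)} where

    ∃₁-map : ∀ {φ ψ} → 𝒯 ∣ Γ ⊢ ∃₁ φ → 𝒯 ∣ φ ∷ List.map wk₁ Γ ⊢ ψ → 𝒯 ∣ Γ ⊢ ∃₁ ψ
    ∃₁-map d e = ∃₁E d (∃₁-fresh e)

    ∃₂-map : ∀ {φ ψ} → 𝒯 ∣ Γ ⊢ ∃₂ φ → 𝒯 ∣ φ ∷ List.map wk₂ Γ ⊢ ψ → 𝒯 ∣ Γ ⊢ ∃₂ ψ
    ∃₂-map d e = ∃₂E d (∃₂-fresh e)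

    ∃-mono : ∀ {α β γ} → 𝒯 ∣ Γ ⊢ ∀₁ (α ⇒̇ β) → 𝒯 ∣ Γ ⊢ ∃₁ (γ ∧̇ α) → 𝒯 ∣ Γ ⊢ ∃₁ (γ ∧̇ β)
    ∃-mono d e = ∃₁-map e (∧I (∧E₁ (hyp i₀))
                              (⇒E (weaken there (∀-open d)) (∧E₂ (hyp i₀))))

  ⇔-trans : ∀ {Γ : List (Formula n k)} {α β γ} →
            𝒯 ∣ Γ ⊢ α ⇔̇ β → 𝒯 ∣ Γ ⊢ β ⇔̇ γ → 𝒯 ∣ Γ ⊢ α ⇔̇ γ
  ⇔-trans d e =
    ∧I (⇒I (⇒E (weaken there (∧E₁ e)) (⇒E (weaken there (∧E₁ d)) (hyp i₀))))
       (⇒I (⇒E (weaken there (∧E₂ d)) (⇒E (weaken there (∧E₂ e)) (hyp i₀))))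

  ¬∃¬⇒∀ : {α β : Formula (suc n) k} → 𝒯 ⊢ ¬̇ (∃₁ (α ∧̇ ¬̇ β)) ⇒̇ ∀₁ (α ⇒̇ β)
  ¬∃¬⇒∀ = ⇒I (∀₁I (⇒I (raa (⇒E (hyp i₂)
            (∃₁-fresh (∧I (hyp i₁) (hyp i₀)))))))

  ∀⇒¬∃¬ : {α β : Formula (suc n) k} → 𝒯 ⊢ ∀₁ (α ⇒̇ β) ⇒̇ ¬̇ (∃₁ (α ∧̇ ¬̇ β))
  ∀⇒¬∃¬ {α = α} {β} = ⇒I (⇒I (∃₁E (hyp i₀) (⇒E (∧E₂ (hyp i₀))
    (⇒E (weaken there (∀-open {Γ = ∃₁ (α ∧̇ ¬̇ β) ∷ ∀₁ (α ⇒̇ β) ∷ []} (hyp i₁)))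
        (∧E₁ (hyp i₀))))))

  -- The rule ≐E for several variables at once; it replaces encoded variables by their
  -- values inside an arbitrary formula.
  leibniz : ∀ {Γ : List (Formula n k)} {σ τ : Fin n′ → Term n} {ρ : Fin k′ → Fin k} →
            (∀ i → 𝒯 ∣ Γ ⊢ σ i ≐ τ i) → ∀ φ → 𝒯 ∣ Γ ⊢ sub σ ρ φ → 𝒯 ∣ Γ ⊢ sub τ ρ φ
  leibniz e (s ≐ t) d = ≐-trans (≐-sym (tsub-≐ e s)) (≐-trans d (tsub-≐ e t))
  leibniz e (s <̇ t) d =
    ⇒E (⇒E (⇒E (inst cong-< (_ ∷ _ ∷ _ ∷ _ ∷ []) []) (tsub-≐ e s)) (tsub-≐ e t)) d
    where
    cong-< : 𝒯 ⊢[ 4 , 0 ] v₀ ≐ v₁ ⇒̇ v₂ ≐ v₃ ⇒̇ v₀ <̇ v₂ ⇒̇ v₁ <̇ v₃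
    cong-< = auto []
  leibniz e (t ∈̇ X) d = ⇒E (⇒E (inst cong-∈ (_ ∷ _ ∷ []) (_ ∷ [])) (tsub-≐ e t)) d
    where
    cong-∈ : 𝒯 ⊢[ 2 , 1 ] v₀ ≐ v₁ ⇒̇ v₀ ∈̇ s₀ ⇒̇ v₁ ∈̇ s₀
    cong-∈ = auto []
  leibniz e ⊥̇       d = d
  leibniz e (φ ∧̇ ψ) d = ∧I (leibniz e φ (∧E₁ d)) (leibniz e ψ (∧E₂ d))
  leibniz e (φ ∨̇ ψ) d = ∨E d (∨I₁ (leibniz (weaken there ∘ e) φ (hyp i₀)))
                             (∨I₂ (leibniz (weaken there ∘ e) ψ (hyp i₀)))
  leibniz e (φ ⇒̇ ψ) d = ⇒I (leibniz (weaken there ∘ e) ψ (⇒E (weaken there d)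
                              (leibniz (≐-sym ∘ weaken there ∘ e) φ (hyp i₀))))
  leibniz e (∀₁ φ) d = ∀₁I (leibniz (λ { zero → ≐I ; (suc i) → ⊢wk₁ (e i) }) φ (∀-open d))
  leibniz e (∃₁ φ) d = ∃₁-map d (leibniz (λ { zero → ≐I ; (suc i) → weaken there (⊢wk₁ (e i)) })
                                         φ (hyp i₀))
  leibniz {σ = σ} {τ} e (∀₂ φ) d = ∀₂I (leibniz (λ i →
    cast (cong₂ _≐_ (tsub-id (λ _ → refl) (σ i)) (tsub-id (λ _ → refl) (τ i))) (⊢wk₂ (e i))) φ (∀₂-open d))
  leibniz {σ = σ} {τ} e (∃₂ φ) d = ∃₂-map d (leibniz (λ i →
    cast (cong₂ _≐_ (tsub-id (λ _ → refl) (σ i)) (tsub-id (λ _ → refl) (τ i)))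
         (weaken there (⊢wk₂ (e i)))) φ (hyp i₀))

  leibniz-⇔ : ∀ {Γ : List (Formula n k)} {σ τ : Fin n′ → Term n} {ρ : Fin k′ → Fin k} →
              (∀ {Δ : List (Formula n k)} i → 𝒯 ∣ Δ ⊢ σ i ≐ τ i) → ∀ φ →
              𝒯 ∣ Γ ⊢ sub σ ρ φ ⇔̇ sub τ ρ φ
  leibniz-⇔ e φ = ∧I (⇒I (leibniz e φ (hyp i₀))) (⇒I (leibniz (≐-sym ∘ e) φ (hyp i₀)))

cases : ∀ {𝒯} {Γ : List (Formula n k)} (α : Formula n k) {χ} →
        𝒯 ∣ α ∷ Γ ⊢ χ → 𝒯 ∣ ¬̇ α ∷ Γ ⊢ χ → 𝒯 ∣ Γ ⊢ χ
cases α d e = ∨E (raa (⇒E (hyp i₀) (∨I₂ (⇒I (⇒E (hyp i₁) (∨I₁ (hyp i₀))))))) d e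

ℱ-total : 𝒯 ⊢[ 1 , 1 ] s₀ ∈ℱ ⇒̇ ∃₁ (⟨ v₁ , v₀ ⟩ ∈̇ s₀)
ℱ-total = ⇒I (∀₁E (∧E₁ (hyp i₀)) v₀)

ℱ-unique : 𝒯 ⊢[ 3 , 1 ] s₀ ∈ℱ ⇒̇ s₀ [ v₀ ]≐ v₁ ⇒̇ s₀ [ v₀ ]≐ v₂ ⇒̇ v₁ ≐ v₂
ℱ-unique = ⇒I (auto (∀₁E (∀₁E (∀₁E (∧E₁ (∧E₂ (hyp i₀))) v₂) v₁) v₀ ◂ []))

-- Consequences of BASIC

module FromBasic {𝒯 : Theory} (basic : ∀ {φ} → BASIC φ → 𝒯 φ) where

  S≢0 : 𝒯 ⊢[ 1 , 0 ] ¬̇ (S v₀ ≐ O)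
  S≢0 = axiom 1 0 (basic S≠0)

  ≮O : 𝒯 ⊢[ 1 , 0 ] ¬̇ (v₀ <̇ O)
  ≮O = axiom 1 0 (basic ≮0)

  <-S : 𝒯 ⊢[ 2 , 0 ] v₀ <̇ S v₁ ⇔̇ (v₀ <̇ v₁ ∨̇ v₀ ≐ v₁)
  <-S = axiom 2 0 (basic <S)

  <-total : 𝒯 ⊢[ 2 , 0 ] v₀ <̇ v₁ ∨̇ v₀ ≐ v₁ ∨̇ v₁ <̇ v₀
  <-total = axiom 2 0 (basic <-tri)

  v<Sv : 𝒯 ⊢[ 1 , 0 ] v₀ <̇ S v₀
  v<Sv = auto (inst <-S (v₀ ∷ v₀ ∷ []) [] ◂ [])

  O<S : 𝒯 ⊢[ 1 , 0 ] O <̇ S v₀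
  O<S = auto (inst <-total (O ∷ S v₀ ∷ []) [] ◂ inst ≮O (S v₀ ∷ []) [] ◂ inst S≢0 (v₀ ∷ []) [] ◂ [])

  H-⟨⟩ : 𝒯 ⊢[ 2 , 0 ] H ⟨ v₀ , v₁ ⟩ ≐ v₀
  H-⟨⟩ = axiom 2 0 (basic H-pair)

  T-⟨⟩ : 𝒯 ⊢[ 2 , 0 ] T ⟨ v₀ , v₁ ⟩ ≐ v₁
  T-⟨⟩ = axiom 2 0 (basic T-pair)

  ⟨⟩≢0 : 𝒯 ⊢[ 2 , 0 ] ¬̇ (⟨ v₀ , v₁ ⟩ ≐ O)
  ⟨⟩≢0 = auto ( inst (axiom 3 0 (basic pair)) (v₀ ∷ v₁ ∷ O ∷ []) []
              ◂ inst (axiom 1 0 (basic ·0)) (𝟐 ∷ []) []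
              ◂ inst (axiom 2 0 (basic +S)) (A ∷ 𝟏 ∷ []) []
              ◂ inst S≢0 (A ⊕ 𝟏 ∷ []) [] ◂ [])
    where A = (v₀ ⊕ v₁) · (v₀ ⊕ v₁ ⊕ 𝟏) ⊕ 𝟐 · v₀

  ⟨⟩-η : 𝒯 ⊢[ 1 , 0 ] ¬̇ (v₀ ≐ O) ⇒̇ ⟨ H v₀ , T v₀ ⟩ ≐ v₀
  ⟨⟩-η = ⇒I (∃₁E d (∃₁E (∧E₂ (hyp i₀)) (auto
           ( inst H-⟨⟩ (v₁ ∷ v₀ ∷ []) [] ◂ inst T-⟨⟩ (v₁ ∷ v₀ ∷ []) [] ◂ []))))
    where
    d = ⇒E (inst (axiom 1 0 (basic pair-sur)) (v₀ ∷ []) [])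
           (auto (inst <-total (O ∷ v₀ ∷ []) [] ◂ inst ≮O (v₀ ∷ []) [] ◂ []))

-- Derivations in RCA₀⁻

module InRCA₀⁻ where

  -- Hypotheses without free number variables hold in every number context.  The following
  -- rules keep such contexts in a form that does not depend on how the number variables
  -- were introduced.
  ⇑ : ∀ {m} → List (Formula 0 k) → List (Formula m k)
  ⇑ = List.map (sub (λ ()) id)

  module _ (Γ : List (Formula 0 k)) where

    ⇑-inst : {φ : Formula m k} → 𝒯 ∣ ⇑ Γ ⊢ φ → (ts : Vec (Term n) m) → 𝒯 ∣ ⇑ Γ ⊢ sub (lookup ts) id φ
    ⇑-inst {m = m} {n = n} d ts = ⊢-sub (lookup ts) id s d
      where
      s : ⇑ Γ ↪⟨ lookup ts , id ⟩ ⇑ Γ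
      s i with ∈-map⁻ _ i
      ... | ψ , j , refl = subst (_∈ᴸ _) (sym (sub-fuse (λ ()) (λ _ → refl) ψ)) (∈-map⁺ _ j)

    ⇑⊆wk₁ : ∀ {ψ : Formula (suc m) k} → ψ ∈ᴸ ⇑ Γ → ψ ∈ᴸ List.map wk₁ (⇑ Γ)
    ⇑⊆wk₁ i with ∈-map⁻ _ i
    ... | ψ , j , refl = subst (_∈ᴸ _) (sub-fuse (λ ()) (λ _ → refl) ψ) (∈-map⁺ wk₁ (∈-map⁺ _ j))

    ⇑-∀I : {φ : Formula (suc m) k} → 𝒯 ∣ ⇑ Γ ⊢ φ → 𝒯 ∣ ⇑ Γ ⊢ ∀₁ φ
    ⇑-∀I d = ∀₁I (weaken ⇑⊆wk₁ d)

    ⇑-open : {φ : Formula (suc m) k} → 𝒯 ∣ ⇑ Γ ⊢ ∀₁ φ → 𝒯 ∣ ⇑ Γ ⊢ φ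
    ⇑-open {m = m} d = weaken s (∀-open d)
      where
      s : ∀ {ψ} → ψ ∈ᴸ List.map wk₁ (⇑ Γ) → ψ ∈ᴸ ⇑ Γ
      s i with ∈-map⁻ wk₁ i
      ... | ψ , j , refl with ∈-map⁻ _ j
      ...   | χ , l , refl = subst (_∈ᴸ _) (sym (sub-fuse (λ ()) (λ _ → refl) χ)) (∈-map⁺ _ l)

    ⇑-wk₂ : ∀ {c} {φ : Formula m k} → 𝒯 ∣ ⇑ Γ ⊢ φ → 𝒯 ∣ ⇑ (c ∷ List.map wk₂ Γ) ⊢ wk₂ φ
    ⇑-wk₂ {m = m} {c = c} = ⊢-sub var suc s
      where
      s : ⇑ Γ ↪⟨ var , suc ⟩ ⇑ (c ∷ List.map wk₂ Γ)
      s i with ∈-map⁻ _ i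
      ... | ψ , j , refl = there (subst (_∈ᴸ _)
        (sub-square (λ ()) (λ _ → refl) ψ) (∈-map⁺ (sub (λ ()) id) (∈-map⁺ wk₂ j)))

    ⇑-close : {φ : Formula 0 k} → 𝒯 ∣ ⇑ Γ ⊢ φ → 𝒯 ∣ Γ ⊢ φ
    ⇑-close = weaken s
      where
      s : ∀ {ψ} → ψ ∈ᴸ ⇑ Γ → ψ ∈ᴸ Γ
      s i with ∈-map⁻ _ i
      ... | ψ , j , refl = subst (_∈ᴸ _) (sym (sub-id (λ ()) (λ _ → refl) ψ)) j

  open FromBasic {RCA₀⁻} basic

  Δ⁰₀-set : {φ : Formula (suc n) k} → Δ⁰₀ φ → RCA₀⁻ ⊢ ∃₂ (∀₁ (v₀ ∈̇ s₀ ⇔̇ wk₂ φ))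
  Δ⁰₀-set {n} {k} δ = axiom n k (comprehension δ)

  at-successor : Fin (suc n) → Term (suc n)
  at-successor zero    = S v₀
  at-successor (suc i) = var (suc i)

  -- The induction axiom for the set that φ defines by comprehension.
  Δ⁰₀-induction : {φ : Formula (suc n) k} → Δ⁰₀ φ →
        RCA₀⁻ ⊢ φ [ O ]₁ → RCA₀⁻ ⊢ φ ⇒̇ sub at-successor id φ → RCA₀⁻ ⊢ φ
  Δ⁰₀-induction {n} {k} {φ} δ z s = ∀-open (∃₂E (Δ⁰₀-set δ) (∀₁I (cast
      (sub-cong (λ { zero → refl ; (suc i) → refl }) (λ _ → refl) φ) (⇒E (∧E₁ (∀-open h)) all))))
    where
    Γ = ∀₁ (v₀ ∈̇ s₀ ⇔̇ wk₂ φ) ∷ []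
    h : RCA₀⁻ ∣ Γ ⊢ ∀₁ (v₀ ∈̇ s₀ ⇔̇ wk₂ φ)
    h = hyp i₀
    base : RCA₀⁻ ∣ Γ ⊢ O ∈̇ s₀
    base = ⇒E (∧E₂ (∀₁E h O))
              (cast (sub-square (λ { zero → refl ; (suc i) → refl }) (λ _ → refl) φ) (weaken (λ ()) (⊢wk₂ z)))
    step : RCA₀⁻ ∣ Γ ⊢ ∀₁ (v₀ ∈̇ s₀ ⇒̇ S v₀ ∈̇ s₀)
    step = ∀₁I (⇒I (⇒E (∧E₂ (weaken there (∀₁E (⊢wk₁ h) (S v₀)))) (cast
      (trans (sub-square {τ′ = at-successor} {σ′ = var} (λ { zero → refl ; (suc i) → refl }) (λ _ → refl) φ)
             (sym (sub-fuse (λ { zero → refl ; (suc i) → refl }) (λ _ → refl) (wk₂ φ))))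
      (⇒E step-wk (⇒E (∧E₁ (weaken there (∀-open h))) (hyp i₀))))))
      where
      step-wk : ∀ {Δ} → RCA₀⁻ ∣ Δ ⊢ wk₂ φ ⇒̇ wk₂ (sub at-successor id φ)
      step-wk = ⊢-sub var suc (λ ()) s
    all : RCA₀⁻ ∣ List.map wk₁ Γ ⊢ v₀ ∈̇ s₀
    all = ∀-open (⇒E (inst (axiom 0 1 induction) [] (s₀ ∷ [])) (∧I base step))

  -- Order

  S<-< : RCA₀⁻ ⊢[ 2 , 0 ] S v₁ <̇ v₀ ⇒̇ v₁ <̇ v₀
  S<-< = Δ⁰₀-induction (⇒Δ <Δ <Δ)
    (auto (inst ≮O (S v₀ ∷ []) [] ◂ []))
    (auto (inst <-S (S v₁ ∷ v₀ ∷ []) [] ◂ inst <-S (v₁ ∷ v₀ ∷ []) [] ◂ inst v<Sv (v₁ ∷ []) [] ◂ []))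

  <-irrefl : RCA₀⁻ ⊢[ 1 , 0 ] ¬̇ (v₀ <̇ v₀)
  <-irrefl = Δ⁰₀-induction (⇒Δ <Δ ⊥Δ)
    (auto (inst ≮O (O ∷ []) [] ◂ []))
    (auto (inst <-S (S v₀ ∷ v₀ ∷ []) [] ◂ inst v<Sv (v₀ ∷ []) [] ◂ inst S<-< (v₀ ∷ v₀ ∷ []) [] ◂ []))

  <-trans : RCA₀⁻ ⊢[ 3 , 0 ] v₁ <̇ v₂ ⇒̇ v₂ <̇ v₀ ⇒̇ v₁ <̇ v₀
  <-trans = Δ⁰₀-induction (⇒Δ <Δ (⇒Δ <Δ <Δ))
    (auto (inst ≮O (v₁ ∷ []) [] ◂ []))
    (auto (inst <-S (v₂ ∷ v₀ ∷ []) [] ◂ inst <-S (v₁ ∷ v₀ ∷ []) [] ◂ []))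

  -- Functions with a Δ⁰₀ graph

  -- In φ the argument is v₁ and the value is v₀.  The function is the set of all w ≠ 0 with
  -- φ(H w, T w): the condition w ≠ 0 keeps 0 out of the set, and costs nothing else because
  -- no pair is 0.
  module _ (φ : Formula 2 k) (δ : Δ⁰₀ {1} {k} (sub (lookup (T v₀ ∷ H v₀ ∷ [])) id φ))
           {Γ : List (Formula 0 k)}
           (total : RCA₀⁻ ∣ ⇑ {m = 1} Γ ⊢ ∃₁ φ)
           (unique : RCA₀⁻ ∣ ⇑ {m = 3} Γ ⊢ sub (lookup (v₁ ∷ v₀ ∷ [])) id φ ⇒̇
                                   sub (lookup (v₂ ∷ v₀ ∷ [])) id φ ⇒̇ v₁ ≐ v₂) where

    private
      code : Formula 1 k
      code = ¬̇ (v₀ ≐ O) ∧̇ sub (lookup (T v₀ ∷ H v₀ ∷ [])) id φ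
      defining : Formula 0 (suc k)
      defining = ∀₁ (v₀ ∈̇ s₀ ⇔̇ wk₂ code)
      Γ⁺ : List (Formula 0 (suc k))
      Γ⁺ = defining ∷ List.map wk₂ Γ

      member : RCA₀⁻ ∣ ⇑ {m = 1} Γ⁺ ⊢ v₀ ∈̇ s₀ ⇔̇ wk₂ code
      member = ⇑-open Γ⁺ (weaken (λ { i₀ → here (sym (sub-id (λ ()) (λ _ → refl) _)) })
                                 (hyp {Γ = defining ∷ []} i₀))

      decode : ∀ i → RCA₀⁻ ∣ ⇑ {m = 2} Γ⁺ ⊢ lookup (T ⟨ v₁ , v₀ ⟩ ∷ H ⟨ v₁ , v₀ ⟩ ∷ []) i ≐ var i
      decode zero       = inst T-⟨⟩ (v₁ ∷ v₀ ∷ []) []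
      decode (suc zero) = inst H-⟨⟩ (v₁ ∷ v₀ ∷ []) []

      graph : RCA₀⁻ ∣ ⇑ {m = 2} Γ⁺ ⊢ ⟨ v₁ , v₀ ⟩ ∈̇ s₀ ⇔̇ wk₂ φ
      graph = ∧I
        (⇒I (leibniz (weaken there ∘ decode) φ (cast eq
          (∧E₂ (⇒E (weaken there (∧E₁ at)) (hyp i₀))))))
        (⇒I (⇒E (weaken there (∧E₂ at)) (∧I (inst ⟨⟩≢0 (v₁ ∷ v₀ ∷ []) [])
          (cast (sym eq) (leibniz (≐-sym ∘ weaken there ∘ decode) φ (hyp i₀))))))
        where
        at = ⇑-inst Γ⁺ {n = 2} member (⟨ v₁ , v₀ ⟩ ∷ [])
        eq = trans (cong (sub _ _) (sub-fuse {σ′ = lookup (T v₀ ∷ H v₀ ∷ [])} {ρ′ = suc}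
               (λ { zero → refl ; (suc zero) → refl }) (λ _ → refl) φ))
             (sub-fuse (λ { zero → refl ; (suc zero) → refl }) (λ _ → refl) φ)

      0∉ : RCA₀⁻ ∣ Γ⁺ ⊢ O ∉̇ s₀
      0∉ = ⇑-close Γ⁺ (⇒I (⇒E (∧E₁ (⇒E (weaken there (∧E₁ (⇑-inst Γ⁺ {n = 0} member (O ∷ []))))
                                      (hyp i₀))) ≐I))

      image : RCA₀⁻ ∣ Γ⁺ ⊢ ∀₁ (∃₁ (⟨ v₁ , v₀ ⟩ ∈̇ s₀))
      image = ⇑-close Γ⁺ (⇑-∀I Γ⁺ (∃₁-map {φ = wk₂ φ}
        (cast (cong ∃₁ (sub-cong (λ { zero → refl ; (suc zero) → refl }) (λ _ → refl) φ))
              (⇑-wk₂ Γ {c = defining} total))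
        (⇒E (∧E₂ (weaken (there ∘ ⇑⊆wk₁ Γ⁺) graph)) (hyp i₀))))

      single : RCA₀⁻ ∣ Γ⁺ ⊢ ∀₁^ 3 (⟨ v₀ , v₁ ⟩ ∈̇ s₀ ∧̇ ⟨ v₀ , v₂ ⟩ ∈̇ s₀ ⇒̇ v₁ ≐ v₂)
      single = ⇑-close Γ⁺ (⇑-∀I Γ⁺ (⇑-∀I Γ⁺ (⇑-∀I Γ⁺ (⇒I (⇒E (⇒E (weaken there (⇑-wk₂ Γ {c = defining} unique))
        (cast (eq v₁) (⇒E (∧E₁ (weaken there (⇑-inst Γ⁺ graph (v₁ ∷ v₀ ∷ [])))) (∧E₁ (hyp i₀)))))
        (cast (eq v₂) (⇒E (∧E₁ (weaken there (⇑-inst Γ⁺ graph (v₂ ∷ v₀ ∷ [])))) (∧E₂ (hyp i₀)))))))))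
        where
        eq : ∀ t → sub (lookup (t ∷ v₀ ∷ [])) id (wk₂ φ) ≡ wk₂ (sub (lookup (t ∷ v₀ ∷ [])) id φ)
        eq t = trans (sub-fuse {σ′ = lookup (t ∷ v₀ ∷ [])} {ρ′ = suc} (λ _ → refl) (λ _ → refl) φ)
                     (sym (sub-fuse (λ { zero → tsub-id (λ _ → refl) t ; (suc zero) → refl })
                                    (λ _ → refl) φ))

    function-with-graph : RCA₀⁻ ∣ Γ ⊢ ∃ℱ (∀₁ (∀₁ (⟨ v₁ , v₀ ⟩ ∈̇ s₀ ⇔̇ wk₂ φ)))
    function-with-graph = ∃₂-map {φ = defining}
      (weaken (λ ()) (Δ⁰₀-set (∧Δ (⇒Δ (≐Δ {s = v₀} {O}) ⊥Δ) δ)))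
      (∧I (∧I image (∧I single 0∉)) (⇑-close Γ⁺ (⇑-∀I Γ⁺ (⇑-∀I Γ⁺ graph))))

  -- The operators

  S-exists : RCA₀⁻ ⊢[ 0 , 0 ] opAxiom Sᵒ
  S-exists = ∃₂-map (function-with-graph (v₀ ≐ S v₁) ≐Δ (∃₁I (S v₀) ≐I) (auto []))
    (∧I (∧E₁ (hyp i₀))
        (∀₁I (auto (∀₁E (∀₁E (∧E₂ (hyp i₀)) v₀) (S v₀) ◂ []))))

  I-exists : RCA₀⁻ ⊢[ 0 , 0 ] opAxiom Iᵒ
  I-exists = ∃₂-map (function-with-graph (v₀ ≐ v₁) ≐Δ (∃₁I v₀ ≐I) (auto []))
    (∧I (∧E₁ (hyp i₀))
        (∀₁I (auto (∀₁E (∀₁E (∧E₂ (hyp i₀)) v₀) v₀ ◂ []))))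

  ⊕-exists : RCA₀⁻ ⊢[ 0 , 0 ] opAxiom ⊕ᵒ
  ⊕-exists = ∃₂-map (function-with-graph (v₀ ≐ H v₁ ⊕ T v₁) ≐Δ (∃₁I (H v₀ ⊕ T v₀) ≐I) (auto []))
    (∧I (∧E₁ (hyp i₀))
        (∀₁I (∀₁I (auto
          ( ∀₁E (∀₁E (∧E₂ (hyp i₀)) ⟨ v₀ , v₁ ⟩) (v₀ ⊕ v₁)
          ◂ ∀₁E (∀₁E (∧E₂ (hyp i₀)) O) O
          ◂ inst H-⟨⟩ (v₀ ∷ v₁ ∷ []) [] ◂ inst T-⟨⟩ (v₀ ∷ v₁ ∷ []) []
          ◂ inst (axiom 0 0 (basic H0)) [] [] ◂ inst (axiom 0 0 (basic T0)) [] []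
          ◂ inst (axiom 1 0 (basic +0)) (O ∷ []) [] ◂ [])))))

  ⊗-exists : RCA₀⁻ ⊢[ 0 , 0 ] opAxiom ⊗ᵒ
  ⊗-exists = ∃₂-map (function-with-graph (v₀ ≐ H v₁ · T v₁) ≐Δ (∃₁I (H v₀ · T v₀) ≐I) (auto []))
    (∧I (∧E₁ (hyp i₀))
        (∀₁I (∀₁I (auto
          ( ∀₁E (∀₁E (∧E₂ (hyp i₀)) ⟨ v₀ , v₁ ⟩) (v₀ · v₁)
          ◂ ∀₁E (∀₁E (∧E₂ (hyp i₀)) O) O
          ◂ inst H-⟨⟩ (v₀ ∷ v₁ ∷ []) [] ◂ inst T-⟨⟩ (v₀ ∷ v₁ ∷ []) []
          ◂ inst (axiom 0 0 (basic H0)) [] [] ◂ inst (axiom 0 0 (basic T0)) [] []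
          ◂ inst (axiom 1 0 (basic ·0)) (O ∷ []) [] ◂ [])))))

  <-exists : RCA₀⁻ ⊢[ 0 , 0 ] opAxiom <ᵒ
  <-exists = ∃₂-map (function-with-graph ((H v₁ <̇ T v₁ ⇒̇ v₀ ≐ 𝟏) ∧̇ (¬̇ (H v₁ <̇ T v₁) ⇒̇ v₀ ≐ O))
      (∧Δ (⇒Δ <Δ ≐Δ) (⇒Δ (⇒Δ <Δ ⊥Δ) ≐Δ))
      (cases (H v₀ <̇ T v₀) (∃₁I 𝟏 (auto [])) (∃₁I O (auto []))) (auto []))
    (∧I (∧E₁ (hyp i₀))
        (∀₁I (∀₁I (auto
          ( ∀₁E (∀₁E (∧E₂ (hyp i₀)) ⟨ v₀ , v₁ ⟩) O
          ◂ ∀₁E (∀₁E (∧E₂ (hyp i₀)) ⟨ v₀ , v₁ ⟩) 𝟏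
          ◂ ∀₁E (∀₁E (∧E₂ (hyp i₀)) O) O
          ◂ inst H-⟨⟩ (v₀ ∷ v₁ ∷ []) [] ◂ inst T-⟨⟩ (v₀ ∷ v₁ ∷ []) []
          ◂ inst (axiom 0 0 (basic H0)) [] [] ◂ inst (axiom 0 0 (basic T0)) [] []
          ◂ inst ≮O (O ∷ []) [] ◂ inst <-irrefl (v₀ ∷ []) []
          ◂ inst <-trans (v₀ ∷ v₀ ∷ v₁ ∷ []) [] ◂ [])))))

  -- The value is H (T x) if H x is 0 and T (T x) otherwise.  The clauses at 0 and at (x, 0)
  -- are included, since H 0 and T 0 are 0.
  D-exists : RCA₀⁻ ⊢[ 0 , 0 ] opAxiom Dᵒ
  D-exists = ∃₂-map (function-with-graph ((H v₁ ≐ O ⇒̇ v₀ ≐ H (T v₁)) ∧̇ (¬̇ (H v₁ ≐ O) ⇒̇ v₀ ≐ T (T v₁)))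
      (∧Δ (⇒Δ ≐Δ ≐Δ) (⇒Δ (⇒Δ ≐Δ ⊥Δ) ≐Δ))
      (cases (H v₀ ≐ O) (∃₁I (H (T v₀)) (auto [])) (∃₁I (T (T v₀)) (auto []))) (auto []))
    (∧I (∧E₁ (hyp i₀))
        (∀₁I (∀₁I (∀₁I (auto
          ( ∀₁E (∀₁E (∧E₂ (hyp i₀)) ⟨ O , ⟨ v₁ , v₂ ⟩ ⟩) v₁
          ◂ ∀₁E (∀₁E (∧E₂ (hyp i₀)) ⟨ S v₀ , ⟨ v₁ , v₂ ⟩ ⟩) v₂
          ◂ ∀₁E (∀₁E (∧E₂ (hyp i₀)) O) O
          ◂ ∀₁E (∀₁E (∧E₂ (hyp i₀)) ⟨ v₀ , O ⟩) O
          ◂ inst H-⟨⟩ (O ∷ ⟨ v₁ , v₂ ⟩ ∷ []) [] ◂ inst T-⟨⟩ (O ∷ ⟨ v₁ , v₂ ⟩ ∷ []) []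
          ◂ inst H-⟨⟩ (S v₀ ∷ ⟨ v₁ , v₂ ⟩ ∷ []) [] ◂ inst T-⟨⟩ (S v₀ ∷ ⟨ v₁ , v₂ ⟩ ∷ []) []
          ◂ inst H-⟨⟩ (v₀ ∷ O ∷ []) [] ◂ inst T-⟨⟩ (v₀ ∷ O ∷ []) []
          ◂ inst H-⟨⟩ (v₁ ∷ v₂ ∷ []) [] ◂ inst T-⟨⟩ (v₁ ∷ v₂ ∷ []) []
          ◂ inst (axiom 0 0 (basic H0)) [] [] ◂ inst (axiom 0 0 (basic T0)) [] []
          ◂ inst S≢0 (v₀ ∷ []) [] ◂ []))))))

  oracle-exists : RCA₀⁻ ⊢[ 0 , 0 ] (∀₂ (∃ℱ (∀₁ ((v₀ ∈̇ s₁ ⇒̇ s₀ [ v₀ ]≐ 𝟏) ∧̇ (v₀ ∉̇ s₁ ⇒̇ s₀ [ v₀ ]≐ O)))))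
  oracle-exists = ∀₂I (∃₂-map (function-with-graph ((v₁ ∈̇ s₀ ⇒̇ v₀ ≐ 𝟏) ∧̇ (v₁ ∉̇ s₀ ⇒̇ v₀ ≐ O))
      (∧Δ (⇒Δ ∈Δ ≐Δ) (⇒Δ (⇒Δ ∈Δ ⊥Δ) ≐Δ))
      (cases (v₀ ∈̇ s₀) (∃₁I 𝟏 (auto [])) (∃₁I O (auto []))) (auto []))
    (∧I (∧E₁ (hyp i₀))
        (∀₁I (auto ( ∀₁E (∀₁E (∧E₂ (hyp i₀)) v₀) O
                   ◂ ∀₁E (∀₁E (∧E₂ (hyp i₀)) v₀) 𝟏 ◂ [])))))

  P-exists : RCA₀⁻ ⊢[ 0 , 0 ] opAxiom Pᵒ
  P-exists = ∀₂I (⇒I (∀₂I (⇒I (∃₂-map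
    (function-with-graph (¬̇ (v₀ ≐ O) ∧̇ s₁ [ v₁ ]≐ H v₀ ∧̇ s₀ [ v₁ ]≐ T v₀)
      (∧Δ (⇒Δ ≐Δ ⊥Δ) (∧Δ ∈Δ ∈Δ))
      (∃₁E (⇒E (inst ℱ-total (v₀ ∷ []) (s₁ ∷ [])) (hyp i₁))
      (∃₁E (⇒E (inst ℱ-total (v₁ ∷ []) (s₀ ∷ [])) (hyp i₁))
      (∃₁I ⟨ v₁ , v₀ ⟩ (auto ( inst H-⟨⟩ (v₁ ∷ v₀ ∷ []) [] ◂ inst T-⟨⟩ (v₁ ∷ v₀ ∷ []) []
                             ◂ inst ⟨⟩≢0 (v₁ ∷ v₀ ∷ []) [] ◂ [])))))
      (auto ( inst ℱ-unique (v₀ ∷ H v₁ ∷ H v₂ ∷ []) (s₁ ∷ [])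
            ◂ inst ℱ-unique (v₀ ∷ T v₁ ∷ T v₂ ∷ []) (s₀ ∷ [])
            ◂ inst ⟨⟩-η (v₁ ∷ []) [] ◂ inst ⟨⟩-η (v₂ ∷ []) [] ◂ [])))
    (∧I (∧E₁ (hyp i₀))
        (∀₁I (∀₁I (∀₁I (auto
          ( ∀₁E (∀₁E (∧E₂ (hyp i₀)) v₀) ⟨ v₁ , v₂ ⟩
          ◂ inst H-⟨⟩ (v₁ ∷ v₂ ∷ []) [] ◂ inst T-⟨⟩ (v₁ ∷ v₂ ∷ []) []
          ◂ inst ⟨⟩≢0 (v₁ ∷ v₂ ∷ []) [] ◂ []))))))))))

  -- z is the least y < b with g(y, x) = 1, or b if there is none.
  isMin : Term n → Term n → Fin k → Term n → Formula n k
  isMin b x g z = z ≤̇ b ∧̇ ∀< z (¬̇ (g [ ⟨ v₀ , twk x ⟩ ]≐ 𝟏)) ∧̇ (z <̇ b ⇒̇ g [ ⟨ z , x ⟩ ]≐ 𝟏)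

  -- Induction on the bound b = v₀ with parameter x = v₁.  The bound S b on the minimum makes
  -- the statement Δ⁰₀.
  min-exists : RCA₀⁻ ⊢[ 2 , 1 ] ∃< (S v₀) (isMin v₁ v₂ s₀ v₀)
  min-exists = Δ⁰₀-induction
    (∃Δ {t = S v₀} {φ = isMin v₁ v₂ s₀ v₀} (∧Δ (∨Δ <Δ ≐Δ) (∧Δ
      (∀Δ {t = v₀} {φ = ¬̇ (s₀ [ ⟨ v₀ , v₃ ⟩ ]≐ 𝟏)} (⇒Δ ∈Δ ⊥Δ)) (⇒Δ <Δ ∈Δ))))
    (∃₁I O (∧I (inst O<S (O ∷ []) []) (∧I (auto []) (∧I
      (∀₁I (auto (inst ≮O (v₀ ∷ []) [] ◂ []))) (auto (inst ≮O (O ∷ []) [] ◂ []))))))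
    -- The minimum for b is one for S b, unless it is b itself and g(b, x) is not 1.
    (⇒I (∃₁E (hyp i₀) (cases (v₀ <̇ v₁ ∨̇ s₀ [ ⟨ v₀ , v₂ ⟩ ]≐ 𝟏)
      (∃₁I v₀ (auto (inst <-S (v₀ ∷ S v₁ ∷ []) [] ◂ [])))
      (∃₁I (S v₀) (∧I (auto (inst <-S (S v₀ ∷ S v₁ ∷ []) [] ◂ []))
        (∧I (auto []) (∧I (∀₁I (auto ( inst <-S (v₀ ∷ v₁ ∷ []) []
          ◂ ∀₁E (∧E₁ (∧E₂ (∧E₂ (hyp i₁)))) v₀ ◂ [])))
          (auto (inst <-irrefl (S v₀ ∷ []) [] ◂ [])))))))))

  μ-exists : RCA₀⁻ ⊢[ 0 , 0 ] opAxiom μᵒ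
  μ-exists = ∀₂I (⇒I (∃₂-map
    (function-with-graph (isMin (H v₁) (T v₁) s₀ v₀)
      (∧Δ (∨Δ <Δ ≐Δ) (∧Δ (∀Δ {t = T v₀} {φ = ¬̇ (s₀ [ ⟨ v₀ , T (H v₁) ⟩ ]≐ 𝟏)} (⇒Δ ∈Δ ⊥Δ)) (⇒Δ <Δ ∈Δ)))
      (∃₁-map (inst min-exists (H v₀ ∷ T v₀ ∷ []) (s₀ ∷ [])) (∧E₂ (hyp i₀)))
      (⇒I (⇒I (auto ( inst <-total (v₁ ∷ v₂ ∷ []) []
                    ◂ ∀₁E (∧E₁ (∧E₂ (hyp i₀))) v₁
                    ◂ ∀₁E (∧E₁ (∧E₂ (hyp i₁))) v₂
                    ◂ inst <-trans (H v₀ ∷ v₁ ∷ v₂ ∷ []) []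
                    ◂ inst <-trans (H v₀ ∷ v₂ ∷ v₁ ∷ []) [] ◂ [])))))
    (∧I (∧E₁ (hyp i₀))
        (∀₁I (∀₁I (∀₁I (∀₁I (auto
          ( ∀₁E (∀₁E (∧E₂ (hyp i₀)) ⟨ v₃ , v₀ ⟩) v₂
          ◂ ⇒I {φ = s₀ [ ⟨ v₃ , v₀ ⟩ ]≐ v₂} (∀₁E (∧E₁ (∧E₂
              (⇒E (∧E₁ (∀₁E (∀₁E (∧E₂ (hyp i₁)) ⟨ v₃ , v₀ ⟩) v₂)) (hyp i₀)))) v₁)
          ◂ ⇒E (∧E₂ (∀₁E (∀₁E (∧E₂ (hyp i₀)) O) O))
               (∧I (auto (inst (axiom 0 0 (basic H0)) [] [] ◂ []))
               (∧I (∀₁I (auto (inst ≮O (v₀ ∷ []) [] ◂ [])))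
                   (auto (inst (axiom 0 0 (basic H0)) [] [] ◂ inst ≮O (O ∷ []) [] ◂ []))))
          ◂ inst H-⟨⟩ (v₃ ∷ v₀ ∷ []) [] ◂ inst T-⟨⟩ (v₃ ∷ v₀ ∷ []) []
          ◂ inst <-total (v₁ ∷ v₂ ∷ []) [] ◂ [])))))))))

  -- The axioms of ΔRA₂

  function-comprehension : RCA₀⁻ ⊢[ 0 , 0 ]
    ∀₁ (∀ℱ (∃₂ (∀₁ (v₀ ∈̇ s₀ ⇔̇ s₁ [ ⟨ v₀ , v₁ ⟩ ]≐ 𝟏))))
  function-comprehension =
    ∀₁I (∀₂I (⇒I (weaken (λ ()) (Δ⁰₀-set {φ = s₀ [ ⟨ v₀ , v₁ ⟩ ]≐ 𝟏} ∈Δ))))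

  ΔRA₂-axiom : ∀ {ψ} → ΔRA₂ ψ → RCA₀⁻ ⊢ ψ
  ΔRA₂-axiom (basic b)     = axiom 0 0 (basic b)
  ΔRA₂-axiom (operator Sᵒ) = S-exists
  ΔRA₂-axiom (operator ⊕ᵒ) = ⊕-exists
  ΔRA₂-axiom (operator ⊗ᵒ) = ⊗-exists
  ΔRA₂-axiom (operator <ᵒ) = <-exists
  ΔRA₂-axiom (operator Iᵒ) = I-exists
  ΔRA₂-axiom (operator Dᵒ) = D-exists
  ΔRA₂-axiom (operator μᵒ) = μ-exists
  ΔRA₂-axiom (operator Pᵒ) = P-exists
  ΔRA₂-axiom (operator ∘ᵒ) = axiom 0 0 composition
  ΔRA₂-axiom oracle        = oracle-exists
  ΔRA₂-axiom comprehension = function-comprehension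

-- Derivations in ΔRA₂

module InΔRA₂ where

  open FromBasic {ΔRA₂} basic

  pattern s₂ = suc (suc zero)
  pattern s₃ = suc (suc (suc zero))
  pattern s₄ = suc (suc (suc (suc zero)))
  pattern s₆ = suc (suc s₄)

  op₀ : (op : Op 0) {Γ : List (Formula n k)} → ΔRA₂ ∣ Γ ⊢ wkSentence (opAxiom op)
  op₀ op = ax (operator op)

  op₁ : (op : Op 1) → ΔRA₂ ⊢[ 0 , 1 ] s₀ ∈ℱ ⇒̇ ∃ℱ (s₀ ≔ op ∙ (s₁ ∷ []))
  op₁ μᵒ = ∀₂-open (axiom 0 0 (operator μᵒ))

  compose : ΔRA₂ ⊢[ 0 , 2 ] s₁ ∈ℱ ⇒̇ s₀ ∈ℱ ⇒̇ ∃ℱ (s₀ ≔ ∘ᵒ ∙ (s₂ ∷ s₁ ∷ []))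
  compose = ⇒I (∀₂-open (⇒E (weaken (λ ()) (∀₂-open (axiom 0 0 (operator ∘ᵒ)))) (hyp i₀)))

  pairing : ΔRA₂ ⊢[ 0 , 2 ] s₁ ∈ℱ ⇒̇ s₀ ∈ℱ ⇒̇ ∃ℱ (s₀ ≔ Pᵒ ∙ (s₂ ∷ s₁ ∷ []))
  pairing = ⇒I (∀₂-open (⇒E (weaken (λ ()) (∀₂-open (axiom 0 0 (operator Pᵒ)))) (hyp i₀)))

  -- If x < y and y ≤ x, then the characteristic function of < takes both values 1 and 0 at
  -- the pair (x, y).
  <-asym : ΔRA₂ ⊢[ 2 , 0 ] v₀ <̇ v₁ ⇒̇ v₁ ≤̇ v₀ ⇒̇ ⊥̇
  <-asym = ∃₂E (op₀ <ᵒ) (auto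
    ( ∀₁E (∀₁E (∧E₂ (hyp i₀)) v₁) v₀
    ◂ inst ℱ-unique (⟨ v₀ , v₁ ⟩ ∷ 𝟏 ∷ O ∷ []) (s₀ ∷ [])
    ◂ inst S≢0 (O ∷ []) [] ◂ []))

  -- F ∘ P(f, g) with f = s₂, g = s₁, F = s₀ outside the quantifier over functions.
  apply₂ : ΔRA₂ ⊢[ 0 , 3 ] s₂ ∈ℱ ⇒̇ s₁ ∈ℱ ⇒̇ s₀ ∈ℱ ⇒̇
           ∃ℱ (∀₁^ 4 (s₃ [ v₀ ]≐ v₁ ∧̇ s₂ [ v₀ ]≐ v₂ ∧̇ s₁ [ ⟨ v₁ , v₂ ⟩ ]≐ v₃ ⇒̇ s₀ [ v₀ ]≐ v₃))
  apply₂ = ⇒I (⇒I (⇒I (∃₂E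
    (⇒E (⇒E (inst pairing [] (s₁ ∷ s₂ ∷ [])) (auto [])) (auto []))
    (∃₂-map (⇒E (⇒E (inst compose [] (s₀ ∷ s₁ ∷ [])) (auto [])) (auto []))
    (∧I (auto []) (∀₁I (∀₁I (∀₁I (∀₁I (auto
      ( ∀₁E (∀₁E (∀₁E (∧E₂ (hyp i₁)) v₂) v₁) v₀
      ◂ ∀₁E (∀₁E (∀₁E (∧E₂ (hyp i₀)) ⟨ v₁ , v₂ ⟩) v₃) v₀ ◂ [])))))))))))

  -- The constant function 0 is <∗ ∘ P(I, I).
  const-O : ΔRA₂ ⊢[ 0 , k ] ∃ℱ (∀₁ (s₀ [ v₀ ]≐ O))
  const-O = ∃₂E (op₀ Iᵒ) (∃₂E (op₀ <ᵒ) (∃₂-map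
    (⇒E (⇒E (⇒E (inst apply₂ [] (s₀ ∷ s₁ ∷ s₁ ∷ [])) (auto [])) (auto [])) (auto []))
    (∧I (auto []) (∀₁I (auto
      ( ∀₁E (∧E₂ (hyp i₂)) v₀
      ◂ ∀₁E (∀₁E (∧E₂ (hyp i₁)) v₀) v₀
      ◂ ∀₁E (∀₁E (∀₁E (∀₁E (∧E₂ (hyp i₀)) O) v₀) v₀) v₀ ◂ []))))))

  const-𝟏 : ΔRA₂ ⊢[ 0 , k ] ∃ℱ (∀₁ (s₀ [ v₀ ]≐ 𝟏))
  const-𝟏 = ∃₂E const-O (∃₂E (op₀ Sᵒ) (∃₂-map
    (⇒E (⇒E (inst compose [] (s₁ ∷ s₀ ∷ [])) (auto [])) (auto []))
    (∧I (auto []) (∀₁I (auto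
      ( ∀₁E (∧E₂ (hyp i₂)) v₀
      ◂ ∀₁E (∧E₂ (hyp i₁)) O
      ◂ ∀₁E (∀₁E (∀₁E (∧E₂ (hyp i₀)) O) 𝟏) v₀ ◂ []))))))

  -- Pointwise operations on functions

  -- For all f and g in ℱ there is h in ℱ with Q at every number.  In the context, f is s₁ and
  -- g is s₀; in Q, f is s₂, g is s₁, h is s₀ and the number is v₀.
  Pointwise : Formula 1 (3 + k) → Set
  Pointwise {k} Q = ΔRA₂ ∣ s₀ ∈ℱ ∷ s₁ ∈ℱ ∷ [] ⊢ ∃ℱ (∀₁ Q)

  -- h(c) = t(f(c))
  value₁ : Term 1 → Formula 1 (3 + k)
  value₁ t = ∀₁ (s₂ [ v₁ ]≐ v₀ ⇒̇ s₀ [ v₁ ]≐ tsub (λ _ → v₀) t)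

  -- h(c) = t(f(c), g(c))
  value₂ : Term 2 → Formula 1 (3 + k)
  value₂ t = ∀₁^ 2 (s₂ [ v₂ ]≐ v₀ ∧̇ s₁ [ v₂ ]≐ v₁ ⇒̇ s₀ [ v₂ ]≐ tsub (lookup (v₀ ∷ v₁ ∷ [])) t)

  pointwise-⟨⟩ : Pointwise {k} (value₂ ⟨ v₀ , v₁ ⟩)
  pointwise-⟨⟩ = ∃₂-map (⇒E (⇒E (inst pairing [] (s₀ ∷ s₁ ∷ [])) (auto [])) (auto []))
    (∧I (auto []) (∀₁I (∀₁I (∀₁I (auto
      (∀₁E (∀₁E (∀₁E (∧E₂ (hyp i₀)) v₁) v₀) v₂ ◂ []))))))

  pointwise-⊕ : Pointwise {k} (value₂ (v₀ ⊕ v₁))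
  pointwise-⊕ = ∃₂E (op₀ ⊕ᵒ) (∃₂-map
    (⇒E (⇒E (⇒E (inst apply₂ [] (s₀ ∷ s₁ ∷ s₂ ∷ [])) (auto [])) (auto [])) (auto []))
    (∧I (auto []) (∀₁I (∀₁I (∀₁I (auto
      ( ∀₁E (∀₁E (∧E₂ (hyp i₁)) v₁) v₀
      ◂ ∀₁E (∀₁E (∀₁E (∀₁E (∧E₂ (hyp i₀)) (v₀ ⊕ v₁)) v₁) v₀) v₂ ◂ [])))))))

  pointwise-· : Pointwise {k} (value₂ (v₀ · v₁))
  pointwise-· = ∃₂E (op₀ ⊗ᵒ) (∃₂-map
    (⇒E (⇒E (⇒E (inst apply₂ [] (s₀ ∷ s₁ ∷ s₂ ∷ [])) (auto [])) (auto [])) (auto []))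
    (∧I (auto []) (∀₁I (∀₁I (∀₁I (auto
      ( ∀₁E (∀₁E (∧E₂ (hyp i₁)) v₁) v₀
      ◂ ∀₁E (∀₁E (∀₁E (∀₁E (∧E₂ (hyp i₀)) (v₀ · v₁)) v₁) v₀) v₂ ◂ [])))))))

  -- h is a characteristic function of f(c) < g(c).
  less : Formula 1 (3 + k)
  less = ∀₁^ 2 (s₂ [ v₂ ]≐ v₀ ∧̇ s₁ [ v₂ ]≐ v₁ ⇒̇
                (v₀ <̇ v₁ ⇒̇ s₀ [ v₂ ]≐ 𝟏) ∧̇ (¬̇ (v₀ <̇ v₁) ⇒̇ s₀ [ v₂ ]≐ O))

  pointwise-< : Pointwise {k} less
  pointwise-< = ∃₂E (op₀ <ᵒ) (∃₂-map
    (⇒E (⇒E (⇒E (inst apply₂ [] (s₀ ∷ s₁ ∷ s₂ ∷ [])) (auto [])) (auto [])) (auto []))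
    (∧I (auto []) (∀₁I (∀₁I (∀₁I (auto
      ( ∀₁E (∀₁E (∧E₂ (hyp i₁)) v₁) v₀
      ◂ inst <-total (v₀ ∷ v₁ ∷ []) []
      ◂ ∀₁E (∀₁E (∀₁E (∀₁E (∧E₂ (hyp i₀)) O) v₁) v₀) v₂
      ◂ ∀₁E (∀₁E (∀₁E (∀₁E (∧E₂ (hyp i₀)) 𝟏) v₁) v₀) v₂ ◂ [])))))))

  pointwise-S : Pointwise {k} (value₁ (S v₀))
  pointwise-S = ∃₂E (op₀ Sᵒ) (∃₂-map
    (⇒E (⇒E (inst compose [] (s₂ ∷ s₀ ∷ [])) (auto [])) (auto []))
    (∧I (auto []) (∀₁I (∀₁I (auto
      ( ∀₁E (∧E₂ (hyp i₁)) v₀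
      ◂ ∀₁E (∀₁E (∀₁E (∧E₂ (hyp i₀)) v₀) (S v₀)) v₁ ◂ []))))))

  -- H x = D(0, x), also for x = 0 because D vanishes at (0, 0).
  pointwise-H : Pointwise {k} (value₁ (H v₀))
  pointwise-H = ∃₂E (weaken (λ ()) const-O) (∃₂E (op₀ Dᵒ) (∃₂-map
    (⇒E (⇒E (⇒E (inst apply₂ [] (s₀ ∷ s₃ ∷ s₁ ∷ [])) (auto [])) (auto [])) (auto []))
    (∧I (auto []) (∀₁I (∀₁I (auto
      ( ∀₁E (∀₁E (∀₁E (∧E₂ (hyp i₁)) (T v₀)) (H v₀)) O
      ◂ ∀₁E (∧E₂ (hyp i₂)) v₁
      ◂ inst ⟨⟩-η (v₀ ∷ []) [] ◂ inst (axiom 0 0 (basic H0)) [] []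
      ◂ ∀₁E (∀₁E (∀₁E (∀₁E (∧E₂ (hyp i₀)) (H v₀)) v₀) O) v₁ ◂ [])))))))

  -- T x = D(1, x), also for x = 0 because D vanishes at (1, 0).
  pointwise-T : Pointwise {k} (value₁ (T v₀))
  pointwise-T = ∃₂E (weaken (λ ()) const-𝟏) (∃₂E (op₀ Dᵒ) (∃₂-map
    (⇒E (⇒E (⇒E (inst apply₂ [] (s₀ ∷ s₃ ∷ s₁ ∷ [])) (auto [])) (auto [])) (auto []))
    (∧I (auto []) (∀₁I (∀₁I (auto
      ( ∀₁E (∀₁E (∀₁E (∧E₂ (hyp i₁)) (T v₀)) (H v₀)) O
      ◂ ∀₁E (∀₁E (∀₁E (∧E₂ (hyp i₁)) (T v₀)) (H v₀)) 𝟏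
      ◂ ∀₁E (∧E₂ (hyp i₂)) v₁
      ◂ inst ⟨⟩-η (v₀ ∷ []) [] ◂ inst (axiom 0 0 (basic T0)) [] []
      ◂ ∀₁E (∀₁E (∀₁E (∀₁E (∧E₂ (hyp i₀)) (T v₀)) v₀) 𝟏) v₁ ◂ [])))))))

  -- h is a characteristic function of f(c) ∈ X.
  elem : Fin k → Formula 1 (3 + k)
  elem X = ∀₁ (s₂ [ v₁ ]≐ v₀ ⇒̇
               (v₀ ∈̇ suc (suc (suc X)) ⇒̇ s₀ [ v₁ ]≐ 𝟏) ∧̇ (v₀ ∉̇ suc (suc (suc X)) ⇒̇ s₀ [ v₁ ]≐ O))

  -- h is a characteristic function of ∃ z < g(c) f(z, c) = 1.
  someBelow : Formula 1 (3 + k)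
  someBelow = ∀₁ (s₁ [ v₁ ]≐ v₀ ⇒̇
    (∃< v₀ (s₂ [ ⟨ v₀ , v₂ ⟩ ]≐ 𝟏) ⇒̇ s₀ [ v₁ ]≐ 𝟏) ∧̇
    (¬̇ (∃< v₀ (s₂ [ ⟨ v₀ , v₂ ⟩ ]≐ 𝟏)) ⇒̇ s₀ [ v₁ ]≐ O))

  -- The lemma is for X = s₀, where the search can compare set variables, and is then
  -- used at an arbitrary X.
  pointwise-∈ : (X : Fin k) → Pointwise {k} (elem X)
  pointwise-∈ X = ⇒E (⇒E (inst lemma [] (s₀ ∷ s₁ ∷ suc (suc X) ∷ [])) (hyp i₀)) (hyp i₁)
    where
    lemma : ΔRA₂ ⊢[ 0 , 3 ] s₀ ∈ℱ ⇒̇ s₁ ∈ℱ ⇒̇ ∃ℱ (∀₁ (elem zero))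
    lemma = ⇒I (⇒I (∃₂E (inst (∀₂-open (axiom 0 0 oracle)) [] (s₂ ∷ [])) (∃₂-map
      (⇒E (⇒E (inst compose [] (s₂ ∷ s₀ ∷ [])) (auto [])) (auto []))
      (∧I (auto []) (∀₁I (∀₁I (auto
        ( ∀₁E (∧E₂ (hyp i₁)) v₀
        ◂ ∀₁E (∀₁E (∀₁E (∧E₂ (hyp i₀)) v₀) 𝟏) v₁
        ◂ ∀₁E (∀₁E (∀₁E (∧E₂ (hyp i₀)) v₀) O) v₁ ◂ []))))))))

  -- Here f is s₀ and g is s₁; x, y, z, b are v₀, v₁, v₂, v₃ in this order.
  μ-clauses : ΔRA₂ ⊢[ 4 , 2 ] s₀ ≔ μᵒ ∙ (s₁ ∷ []) ⇒̇
    (s₀ [ ⟨ v₃ , v₀ ⟩ ]≐ v₂ ⇒̇ v₂ ≤̇ v₃) ∧̇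
    (s₀ [ ⟨ v₃ , v₀ ⟩ ]≐ v₂ ∧̇ v₁ <̇ v₃ ∧̇ s₁ [ ⟨ v₁ , v₀ ⟩ ]≐ 𝟏 ⇒̇ v₂ ≤̇ v₁) ∧̇
    (s₀ [ ⟨ v₃ , v₀ ⟩ ]≐ v₂ ∧̇ v₂ <̇ v₃ ⇒̇ s₁ [ ⟨ v₂ , v₀ ⟩ ]≐ 𝟏)
  μ-clauses = ⇒I (auto (∀₁E (∀₁E (∀₁E (∀₁E (hyp i₀) v₃) v₂) v₁) v₀ ◂ []))

  -- A witness below b = g(c) exists just when the minimum m(c) = μ(f)(b, c) is below b, so
  -- h is <∗ ∘ P(m, g).  The sets h, <∗, m, I, μ(f), g, f are s₀, …, s₆ in the end, and then
  -- z = m(c), b, c are v₀, v₁, v₂.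
  pointwise-∃ : Pointwise {k} someBelow
  pointwise-∃ =
    ∃₂E (⇒E (inst (op₁ μᵒ) [] (s₁ ∷ [])) (auto []))
    (∃₂E (op₀ Iᵒ)
    (∃₂E (⇒E (⇒E (⇒E (inst apply₂ [] (s₁ ∷ s₀ ∷ s₂ ∷ [])) (auto [])) (auto [])) (auto []))
    (∃₂E (op₀ <ᵒ)
    (∃₂-map (⇒E (⇒E (⇒E (inst apply₂ [] (s₀ ∷ s₄ ∷ s₁ ∷ [])) (auto [])) (auto [])) (auto []))
    (∧I (auto []) (∀₁I (∀₁I (⇒I
    (∃₁E (⇒E (inst ℱ-total (⟨ v₀ , v₁ ⟩ ∷ []) (s₄ ∷ [])) (auto []))
    (auto
      ( ⇒I {φ = ∃< v₁ (s₆ [ ⟨ v₀ , v₃ ⟩ ]≐ 𝟏)} {ψ = v₀ <̇ v₁} (∃₁E (hyp i₀) (auto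
          ( inst μ-clauses (v₃ ∷ v₀ ∷ v₁ ∷ v₂ ∷ []) (s₄ ∷ s₆ ∷ [])
          ◂ inst <-asym (v₀ ∷ v₂ ∷ []) [] ◂ [])))
      ◂ ⇒I {φ = v₀ <̇ v₁} {ψ = ∃< v₁ (s₆ [ ⟨ v₀ , v₃ ⟩ ]≐ 𝟏)} (∃₁I v₀ (auto
          ( inst μ-clauses (v₂ ∷ v₀ ∷ v₀ ∷ v₁ ∷ []) (s₄ ∷ s₆ ∷ []) ◂ [])))
      ◂ inst μ-clauses (v₂ ∷ v₀ ∷ v₀ ∷ v₁ ∷ []) (s₄ ∷ s₆ ∷ [])
      ◂ ∀₁E (∀₁E (∀₁E (∀₁E (∧E₂ (hyp i₄)) v₀) v₂) v₁) v₂
      ◂ ∀₁E (∧E₂ (hyp i₅)) v₂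
      ◂ ∀₁E (∀₁E (∧E₂ (hyp i₃)) v₁) v₀
      ◂ ∀₁E (∀₁E (∀₁E (∀₁E (∧E₂ (hyp i₂)) 𝟏) v₁) v₀) v₂
      ◂ ∀₁E (∀₁E (∀₁E (∀₁E (∧E₂ (hyp i₂)) O) v₁) v₀) v₂ ◂ [])))))))))))

  -- Representable terms and formulas

  -- What a function does with its argument v₀: it computes a term, or it decides a formula.
  data Spec (k : ℕ) : Set where
    term : Term 1 → Spec k
    pred : Formula 1 k → Spec k

  -- Specifications come with a map ρ of set variables, so that in larger set contexts they
  -- are again specifications of the same form, by Realizes-sub.
  body : Spec k → (Fin k → Fin k′) → Fin k′ → Formula 1 k′
  body (term t) ρ X = X [ v₀ ]≐ t
  body (pred θ) ρ X = (sub var ρ θ ⇒̇ X [ v₀ ]≐ 𝟏) ∧̇ (¬̇ (sub var ρ θ) ⇒̇ X [ v₀ ]≐ O)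

  Realizes : Spec k → (Fin k → Fin k′) → Fin k′ → Formula 0 k′
  Realizes s ρ X = X ∈ℱ ∧̇ ∀₁ (body s ρ X)

  Representable : Spec k → Set
  Representable s = ΔRA₂ ⊢ ∃₂ (Realizes s suc zero)

  Realizes-sub : (s : Spec k) (ρ : Fin k → Fin k′) (X : Fin k′) {k″ : ℕ} (π : Fin k′ → Fin k″) →
              sub var π (Realizes s ρ X) ≡ Realizes s (π ∘ ρ) (π X)
  Realizes-sub (term t) ρ X π =
    cong (λ u → π X ∈ℱ ∧̇ ∀₁ (π X [ v₀ ]≐ u)) (tsub-id (λ { zero → refl }) t)
  Realizes-sub (pred θ) ρ X π =
    cong (λ ψ → π X ∈ℱ ∧̇ ∀₁ ((ψ ⇒̇ π X [ v₀ ]≐ 𝟏) ∧̇ (¬̇ ψ ⇒̇ π X [ v₀ ]≐ O)))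
         (sub-fuse (λ { zero → refl }) (λ _ → refl) θ)

  suc³ : Fin k → Fin (3 + k)
  suc³ i = suc (suc (suc i))

  suc² : Fin k → Fin (2 + k)
  suc² i = suc (suc i)

  -- The existential quantifiers over sets are eliminated here once and for all; what remains
  -- for each operation is to derive a property of h from those of f and g.
  combine : {s t u : Spec k} {Q : Formula 1 (3 + k)} → Representable s → Representable t → Pointwise Q →
    (∀ {Γ} → ΔRA₂ ∣ Γ ⊢ Realizes s suc³ s₂ → ΔRA₂ ∣ Γ ⊢ Realizes t suc³ s₁ →
             ΔRA₂ ∣ Γ ⊢ ∀₁ Q → ΔRA₂ ∣ Γ ⊢ ∀₁ (body u suc³ s₀)) → Representable u
  combine {s = s} {t} {u} {Q} a b q step =
    ∃₂E a (∃₂E {φ = Realizes t suc² zero}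
      (weaken {Γ = []} (λ ()) (cast (cong ∃₂ (Realizes-sub t suc zero (lift₂ suc))) (⊢-sub var suc (λ ()) b)))
      (∃₂E {φ = s₀ ∈ℱ ∧̇ ∀₁ Q}
        (cut (∧E₁ (cast (Realizes-sub s suc zero suc) (hyp i₁)))
          (cut (∧E₁ (hyp i₁))
            (weaken (λ { i₀ → i₀ ; i₁ → i₁ }) q)))
        (∃₂I zero (cast (sym goal≡)
          (∧I (∧E₁ (hyp i₀))
              (step (cast (trans (cong wk₂ (Realizes-sub s suc zero suc)) (Realizes-sub s suc² s₁ suc))
                          (hyp i₂))
                    (cast (Realizes-sub t suc² s₀ suc) (hyp i₁))
                    (∧E₂ (hyp i₀))))))))
    where
    goal≡ : sub var (inst₂ zero) (sub var (lift₂ suc) (sub var (lift₂ suc)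
              (sub var (lift₂ suc) (Realizes u suc zero)))) ≡ Realizes u suc³ s₀
    goal≡ = trans (cong (sub var (inst₂ zero)) (trans (cong (sub var (lift₂ suc)) (trans
              (cong (sub var (lift₂ suc)) (Realizes-sub u suc zero (lift₂ suc)))
              (Realizes-sub u _ zero (lift₂ suc)))) (Realizes-sub u _ zero (lift₂ suc))))
              (Realizes-sub u _ zero (inst₂ zero))

  pointwise₃ : ∀ {Γ : List (Formula n k)} {α β γ δ} →
    𝒯 ∣ Γ ⊢ ∀₁ α → 𝒯 ∣ Γ ⊢ ∀₁ β → 𝒯 ∣ Γ ⊢ ∀₁ γ →
    (∀ {Δ : List (Formula (suc n) k)} → 𝒯 ∣ Δ ⊢ α → 𝒯 ∣ Δ ⊢ β → 𝒯 ∣ Δ ⊢ γ → 𝒯 ∣ Δ ⊢ δ) → 𝒯 ∣ Γ ⊢ ∀₁ δ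
  pointwise₃ a b c d = ∀₁I (d (∀-open a) (∀-open b) (∀-open c))

  inst² : Term n → Term n → Fin (2 + n) → Term n
  inst² s t zero          = s
  inst² s t (suc zero)    = t
  inst² s t (suc (suc i)) = var i

  ∀²E : ∀ {Γ : List (Formula n k)} {φ} → 𝒯 ∣ Γ ⊢ ∀₁ (∀₁ φ) → ∀ s t → 𝒯 ∣ Γ ⊢ sub (inst² s t) id φ
  ∀²E {φ = φ} d s t = cast (sub-fuse (λ { zero → refl ; (suc zero) → inst-twk s t ; (suc (suc i)) → refl })
                                     (λ _ → refl) φ) (∀₁E (∀₁E d t) s)

  rep-O : Representable {k} (term O)
  rep-O = const-O

  rep-v₀ : Representable {k} (term v₀)
  rep-v₀ = op₀ Iᵒ

  rep-unary : (t : Term 1) {s : Term 1} → Representable {k} (term s) → Pointwise {k} (value₁ t) →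
              Representable {k} (term (tsub (λ _ → s) t))
  rep-unary t {s} a q = combine a a q λ x _ z → pointwise₃ (∧E₂ x) (∧E₂ x) z
    λ x _ z → cast (cong (λ u → s₀ [ v₀ ]≐ u) (tsub-tsub _ _ t)) (⇒E (∀₁E z s) x)

  rep-binary : (t : Term 2) {s u : Term 1} → Representable {k} (term s) → Representable {k} (term u) →
               Pointwise {k} (value₂ t) → Representable {k} (term (tsub (lookup (s ∷ u ∷ [])) t))
  rep-binary t {s} {u} a b q = combine a b q λ x y z → pointwise₃ (∧E₂ x) (∧E₂ y) z
    λ x y z → cast (cong (λ r → s₀ [ v₀ ]≐ r)
       (trans (tsub-tsub _ _ t) (tsub-cong (λ { zero → refl ; (suc zero) → refl }) t))) (⇒E (∀²E z s u) (∧I x y))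

  rep-term : (t : Term 1) → Representable {k} (term t)
  rep-term (var zero) = rep-v₀
  rep-term O          = rep-O
  rep-term (S t)      = rep-unary (S v₀) (rep-term t) pointwise-S
  rep-term (H t)      = rep-unary (H v₀) (rep-term t) pointwise-H
  rep-term (T t)      = rep-unary (T v₀) (rep-term t) pointwise-T
  rep-term (s ⊕ t)    = rep-binary (v₀ ⊕ v₁) (rep-term s) (rep-term t) pointwise-⊕
  rep-term (s · t)    = rep-binary (v₀ · v₁) (rep-term s) (rep-term t) pointwise-·
  rep-term ⟨ s , t ⟩  = rep-binary ⟨ v₀ , v₁ ⟩ (rep-term s) (rep-term t) pointwise-⟨⟩

  rep-< : (s t : Term 1) → Representable {k} (pred (s <̇ t))
  rep-< s t = combine {u = pred (s <̇ t)} (rep-term s) (rep-term t) pointwise-<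
    λ x y z → pointwise₃ (∧E₂ x) (∧E₂ y) z λ x y z → cast
      (cong₂ (λ s t → (s <̇ t ⇒̇ s₀ [ v₀ ]≐ 𝟏) ∧̇ (¬̇ (s <̇ t) ⇒̇ s₀ [ v₀ ]≐ O))
             (sym (tsub-id (λ _ → refl) s)) (sym (tsub-id (λ _ → refl) t)))
      (⇒E (∀²E z s t) (∧I x y))

  rep-∈ : (t : Term 1) (X : Fin k) → Representable {k} (pred (t ∈̇ X))
  rep-∈ t X = combine {u = pred (t ∈̇ X)} (rep-term t) (rep-term t) (pointwise-∈ X)
    λ x y z → pointwise₃ (∧E₂ x) (∧E₂ y) z λ x y z → cast
      (cong (λ t → (t ∈̇ _ ⇒̇ s₀ [ v₀ ]≐ 𝟏) ∧̇ (t ∉̇ _ ⇒̇ s₀ [ v₀ ]≐ O))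
            (sym (tsub-id (λ _ → refl) t)))
      (⇒E (∀₁E z t) x)

  rep-⊥ : Representable {k} (pred ⊥̇)
  rep-⊥ {k} = ∃₂-map const-O (∧I (∧E₁ (hyp i₀))
    (∀₁I (∧I (⇒I (exfalso (hyp i₀))) (⇒I (weaken there zeros)))))
    where
    zeros : ΔRA₂ ∣ List.map wk₁ ((s₀ ∈ℱ ∧̇ ∀₁ (s₀ [ v₀ ]≐ O)) ∷ []) ⊢ s₀ [ v₀ ]≐ O
    zeros = ∀-open {k = suc k} {Γ = (s₀ ∈ℱ ∧̇ ∀₁ (s₀ [ v₀ ]≐ O)) ∷ []} (∧E₂ (hyp i₀))

  rep-⊤ : Representable {k} (pred ⊤̇)
  rep-⊤ {k} = ∃₂-map const-𝟏 (∧I (∧E₁ (hyp i₀))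
    (∀₁I (∧I (⇒I (weaken there ones)) (⇒I (exfalso (⇒E (hyp i₀) (⇒I (hyp i₀))))))))
    where
    ones : ΔRA₂ ∣ List.map wk₁ ((s₀ ∈ℱ ∧̇ ∀₁ (s₀ [ v₀ ]≐ 𝟏)) ∷ []) ⊢ s₀ [ v₀ ]≐ 𝟏
    ones = ∀-open {k = suc k} {Γ = (s₀ ∈ℱ ∧̇ ∀₁ (s₀ [ v₀ ]≐ 𝟏)) ∷ []} (∧E₂ (hyp i₀))

  rep-equiv : {θ η : Formula 1 k} → ΔRA₂ ⊢ θ ⇒̇ η → ΔRA₂ ⊢ η ⇒̇ θ → Representable (pred θ) → Representable (pred η)
  rep-equiv {k} {θ} {η} d e r = ∃₂-map r (∧I (∧E₁ (hyp i₀)) (∀₁I (∧I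
    (⇒I (⇒E (∧E₁ b) (⇒E e′ (hyp i₀))))
    (⇒I (⇒E (∧E₂ b) (⇒I (⇒E (hyp i₁) (⇒E d′ (hyp i₀)))))))))
    where
    b : ∀ {ψ} → ΔRA₂ ∣ ψ ∷ List.map wk₁ (Realizes (pred θ) suc zero ∷ []) ⊢ body (pred θ) suc zero
    b = weaken there (∀-open {Γ = Realizes (pred θ) suc zero ∷ []} (∧E₂ (hyp i₀)))
    d′ : ∀ {Δ} → ΔRA₂ ∣ Δ ⊢ wk₂ θ ⇒̇ wk₂ η
    d′ = ⊢-sub var suc (λ ()) d
    e′ : ∀ {Δ} → ΔRA₂ ∣ Δ ⊢ wk₂ η ⇒̇ wk₂ θ
    e′ = ⊢-sub var suc (λ ()) e

  -- Among the values 0 and 1, χ(η) < χ(θ) holds only for χ(η) = 0 and χ(θ) = 1.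
  rep-∧¬ : {θ η : Formula 1 k} → Representable (pred θ) → Representable (pred η) → Representable (pred (θ ∧̇ ¬̇ η))
  rep-∧¬ {k} {θ} {η} a b = combine {s = pred η} {t = pred θ} {u = pred (θ ∧̇ ¬̇ η)} b a pointwise-<
    λ x y z → pointwise₃ (∧E₂ x) (∧E₂ y) z λ {Δ} x y z → ∧I
      (⇒I (⇒E (∧E₁ (compare O 𝟏 (weaken there z)
                      (⇒E (∧E₂ (weaken there x)) (∧E₂ (hyp i₀)))
                      (⇒E (∧E₁ (weaken there y)) (∧E₁ (hyp i₀)))))
              (inst O<S (O ∷ []) [])))
      (⇒I (cases η′
        (cases θ′
          (⇒E (∧E₂ (compare 𝟏 𝟏 (weaken (there ∘ there ∘ there) z)
                      (⇒E (∧E₁ (weaken (there ∘ there ∘ there) x)) (hyp i₁))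
                      (⇒E (∧E₁ (weaken (there ∘ there ∘ there) y)) (hyp i₀))))
              (inst <-irrefl (𝟏 ∷ []) []))
          (⇒E (∧E₂ (compare 𝟏 O (weaken (there ∘ there ∘ there) z)
                      (⇒E (∧E₁ (weaken (there ∘ there ∘ there) x)) (hyp i₁))
                      (⇒E (∧E₂ (weaken (there ∘ there ∘ there) y)) (hyp i₀))))
              (inst ≮O (𝟏 ∷ []) [])))
        (⇒E (∧E₂ (compare O O (weaken (there ∘ there) z)
                    (⇒E (∧E₂ (weaken (there ∘ there) x)) (hyp i₀))
                    (⇒E (∧E₂ (weaken (there ∘ there) y)) (⇒I (⇒E (hyp i₂)
                      (∧I (hyp i₀) (hyp i₁)))))))
            (inst ≮O (O ∷ []) []))))
    where
    θ′ η′ : Formula 1 (3 + k)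
    θ′ = sub var suc³ θ
    η′ = sub var suc³ η
    compare : ∀ {Δ : List (Formula 1 (3 + k))} s t → ΔRA₂ ∣ Δ ⊢ less →
              ΔRA₂ ∣ Δ ⊢ s₂ [ v₀ ]≐ s → ΔRA₂ ∣ Δ ⊢ s₁ [ v₀ ]≐ t →
              ΔRA₂ ∣ Δ ⊢ (s <̇ t ⇒̇ s₀ [ v₀ ]≐ 𝟏) ∧̇ (¬̇ (s <̇ t) ⇒̇ s₀ [ v₀ ]≐ O)
    compare s t z x y = ⇒E (∀²E z s t) (∧I x y)
    <-irrefl : ΔRA₂ ⊢[ 1 , 0 ] ¬̇ (v₀ <̇ v₀)
    <-irrefl = auto (inst <-asym (v₀ ∷ v₀ ∷ []) [] ◂ [])

  rep-¬ : {θ : Formula 1 k} → Representable (pred θ) → Representable (pred (¬̇ θ))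
  rep-¬ a = rep-equiv (⇒I (∧E₂ (hyp i₀))) (⇒I (∧I (⇒I (hyp i₀)) (hyp i₀)))
                      (rep-∧¬ rep-⊤ a)

  rep-∧ : {θ η : Formula 1 k} → Representable (pred θ) → Representable (pred η) → Representable (pred (θ ∧̇ η))
  rep-∧ a b = rep-equiv
    (⇒I (∧I (∧E₁ (hyp i₀)) (raa (⇒E (∧E₂ (hyp i₁)) (hyp i₀)))))
    (⇒I (∧I (∧E₁ (hyp i₀)) (⇒I (⇒E (hyp i₀) (∧E₂ (hyp i₁))))))
    (rep-∧¬ a (rep-¬ b))

  rep-⇒ : {θ η : Formula 1 k} → Representable (pred θ) → Representable (pred η) → Representable (pred (θ ⇒̇ η))
  rep-⇒ a b = rep-equiv
    (⇒I (⇒I (raa (⇒E (hyp i₂) (∧I (hyp i₁) (hyp i₀))))))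
    (⇒I (⇒I (⇒E (∧E₂ (hyp i₀)) (⇒E (hyp i₁) (∧E₁ (hyp i₀))))))
    (rep-¬ (rep-∧¬ a b))

  rep-∨ : {θ η : Formula 1 k} → Representable (pred θ) → Representable (pred η) → Representable (pred (θ ∨̇ η))
  rep-∨ {θ = θ} a b = rep-equiv
    (⇒I (cases θ (∨I₁ (hyp i₀)) (∨I₂ (⇒E (hyp i₁) (hyp i₀)))))
    (⇒I (⇒I (∨E (hyp i₁)
      (exfalso (⇒E (hyp i₁) (hyp i₀))) (hyp i₀))))
    (rep-⇒ (rep-¬ a) b)

  rep-≐ : (s t : Term 1) → Representable {k} (pred (s ≐ t))
  rep-≐ s t = rep-equiv {θ = ¬̇ (s <̇ t) ∧̇ ¬̇ (t <̇ s)} (inst from (s ∷ t ∷ []) []) (inst to (s ∷ t ∷ []) [])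
                        (rep-∧ {θ = ¬̇ (s <̇ t)} {η = ¬̇ (t <̇ s)} (rep-¬ {θ = s <̇ t} (rep-< s t))
                                                            (rep-¬ {θ = t <̇ s} (rep-< t s)))
    where
    from : ΔRA₂ ⊢[ 2 , 0 ] ¬̇ (v₀ <̇ v₁) ∧̇ ¬̇ (v₁ <̇ v₀) ⇒̇ v₀ ≐ v₁
    from = auto (inst <-total (v₀ ∷ v₁ ∷ []) [] ◂ [])
    to : ΔRA₂ ⊢[ 2 , 0 ] v₀ ≐ v₁ ⇒̇ ¬̇ (v₀ <̇ v₁) ∧̇ ¬̇ (v₁ <̇ v₀)
    to = auto (inst <-asym (v₀ ∷ v₀ ∷ []) [] ◂ [])

  module _ {Γ : List (Formula 0 k′)} {θ : Formula 1 k} {ρ : Fin k → Fin k′} {X : Fin k′}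
           (x : ΔRA₂ ∣ Γ ⊢ Realizes (pred θ) ρ X) where

    realizes-⇔ : ΔRA₂ ∣ Γ ⊢ ∀₁ (X [ v₀ ]≐ 𝟏 ⇔̇ sub var ρ θ)
    realizes-⇔ = ∀₁I (∧I (⇒I (raa (⇒E (inst S≢0 (O ∷ []) []) (⇒E (⇒E (⇒E
        (inst ℱ-unique (v₀ ∷ 𝟏 ∷ O ∷ []) (X ∷ []))
        (weaken (there ∘ there) (⊢wk₁ (∧E₁ x))))
        (hyp i₁))
        (⇒E (weaken (there ∘ there) (∧E₂ (∀-open (∧E₂ x)))) (hyp i₀))))))
      (∧E₁ (∀-open (∧E₂ x))))

    on-pairs : ΔRA₂ ∣ List.map wk₁ (List.map wk₁ Γ) ⊢
               X [ ⟨ v₀ , v₁ ⟩ ]≐ 𝟏 ⇔̇ sub (λ _ → ⟨ v₀ , v₁ ⟩) ρ θ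
    on-pairs = cast (cong (X [ ⟨ v₀ , v₁ ⟩ ]≐ 𝟏 ⇔̇_) eq) (∀₁E (⊢wk₁ (⊢wk₁ realizes-⇔)) ⟨ v₀ , v₁ ⟩)
      where
      eq : sub (inst₁ ⟨ v₀ , v₁ ⟩) id (sub (lift₁ (var ∘ suc)) id (sub (lift₁ (var ∘ suc)) id
             (sub var ρ θ))) ≡ sub (λ _ → ⟨ v₀ , v₁ ⟩) ρ θ
      eq = trans (cong (sub _ _) (trans (cong (sub _ _)
             (sub-fuse {σ′ = λ _ → v₀} {ρ′ = ρ} (λ { zero → refl }) (λ _ → refl) θ))
             (sub-fuse {σ′ = λ _ → v₀} {ρ′ = ρ} (λ { zero → refl }) (λ _ → refl) θ)))
           (sub-fuse (λ _ → refl) (λ _ → refl) θ)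

  -- In ψ the bound variable z is v₀ and the argument c is v₁.  On a pair (z, c), the formula
  -- ψ(H v₀, T v₀) says ψ(z, c), so its characteristic function is what someBelow needs.
  rep-∃< : {t : Term 1} {ψ : Formula 2 k} → Representable (pred (sub (lookup (H v₀ ∷ T v₀ ∷ [])) id ψ)) →
           Representable (term {k} t) → Representable (pred (∃< t ψ))
  rep-∃< {k} {t} {ψ} a b = combine {s = pred ψ-code} {t = term t} {u = pred (∃< t ψ)} a b pointwise-∃
    λ x y z → cast (cong (λ u → ∀₁ ((∃₁ (v₀ <̇ u ∧̇ ψ′) ⇒̇ s₀ [ v₀ ]≐ 𝟏)
                                  ∧̇ (¬̇ (∃₁ (v₀ <̇ u ∧̇ ψ′)) ⇒̇ s₀ [ v₀ ]≐ O)))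
                        (sym (trans (tsub-tsub _ _ t) (tsub-cong (λ _ → refl) t))))
      (∀₁I (∧I
        (⇒I (⇒E (∧E₁ (weaken there (clause y z)))
                (∃-mono (weaken there (∀₁I (∧E₂ (ψ-on-pairs x)))) (hyp i₀))))
        (⇒I (⇒E (∧E₂ (weaken there (clause y z))) (⇒I (⇒E (hyp i₁)
                (∃-mono (weaken (there ∘ there) (∀₁I (∧E₁ (ψ-on-pairs x)))) (hyp i₀))))))))
    where
    ψ-code : Formula 1 k
    ψ-code = sub (lookup (H v₀ ∷ T v₀ ∷ [])) id ψ
    ψ′ : Formula 2 (3 + k)
    ψ′ = sub (lift₁ var) suc³ ψ
    clause : ∀ {Γ} → ΔRA₂ ∣ Γ ⊢ Realizes (term t) suc³ s₁ → ΔRA₂ ∣ Γ ⊢ ∀₁ someBelow →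
             ΔRA₂ ∣ List.map wk₁ Γ ⊢ (∃< t (s₂ [ ⟨ v₀ , v₁ ⟩ ]≐ 𝟏) ⇒̇ s₀ [ v₀ ]≐ 𝟏)
                                   ∧̇ (¬̇ (∃< t (s₂ [ ⟨ v₀ , v₁ ⟩ ]≐ 𝟏)) ⇒̇ s₀ [ v₀ ]≐ O)
    clause y z = ⇒E (∀₁E (∀-open z) t) (∀-open (∧E₂ y))
    coded : Fin 2 → Term 2
    coded = lookup (H ⟨ v₀ , v₁ ⟩ ∷ T ⟨ v₀ , v₁ ⟩ ∷ [])
    decode : ∀ {Δ : List (Formula 2 (3 + k))} i → ΔRA₂ ∣ Δ ⊢ coded i ≐ lift₁ var i
    decode zero       = inst H-⟨⟩ (v₀ ∷ v₁ ∷ []) []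
    decode (suc zero) = inst T-⟨⟩ (v₀ ∷ v₁ ∷ []) []
    ψ-on-pairs : ∀ {Γ} → ΔRA₂ ∣ Γ ⊢ Realizes (pred ψ-code) suc³ s₂ →
                 ΔRA₂ ∣ List.map wk₁ (List.map wk₁ Γ) ⊢ s₂ [ ⟨ v₀ , v₁ ⟩ ]≐ 𝟏 ⇔̇ ψ′
    ψ-on-pairs x = ⇔-trans
      (cast (cong (s₂ [ ⟨ v₀ , v₁ ⟩ ]≐ 𝟏 ⇔̇_)
                  (sub-fuse (λ { zero → refl ; (suc zero) → refl }) (λ _ → refl) ψ)) (on-pairs x))
      (leibniz-⇔ decode ψ)

  -- The components of the code v₀ of a tuple; lifting below a quantifier agrees with coding,
  -- since the code of the longer tuple is the pair of the new variable and the old code.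
  proj : Fin n → Term 1
  proj zero    = H v₀
  proj (suc i) = tsub (λ _ → T v₀) (proj i)

  rep : {φ : Formula n k} → Δ⁰₀ φ → Representable (pred (sub proj id φ))
  rep-bounded : (t : Term n) {φ : Formula (suc n) k} → Representable (pred (sub proj id φ)) →
                Representable (pred (sub proj id (∃< t φ)))
  rep-bounded t {φ} a = subst (λ u → Representable (pred (∃₁ (v₀ <̇ u ∧̇ sub (lift₁ proj) id φ))))
                              (sym (twk-tsub proj t))
    (rep-∃< {ψ = sub (lift₁ proj) id φ} (subst (Representable ∘ pred) (sym eq) a) (rep-term (tsub proj t)))
    where
    eq : sub (lookup (H v₀ ∷ T v₀ ∷ [])) id (sub (lift₁ proj) id φ) ≡ sub proj id φ
    eq = sub-fuse (λ { zero → refl ; (suc i) → trans (tsub-tsub _ _ (proj i))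
                                                     (tsub-cong (λ { zero → refl }) (proj i)) }) (λ _ → refl) φ

  rep (≐Δ {s} {t})     = rep-≐ (tsub proj s) (tsub proj t)
  rep (<Δ {s} {t})     = rep-< (tsub proj s) (tsub proj t)
  rep (∈Δ {t} {X})     = rep-∈ (tsub proj t) X
  rep ⊥Δ               = rep-⊥
  rep (∧Δ {φ} {ψ} d e) = rep-∧ {θ = sub proj id φ} {sub proj id ψ} (rep d) (rep e)
  rep (∨Δ {φ} {ψ} d e) = rep-∨ {θ = sub proj id φ} {sub proj id ψ} (rep d) (rep e)
  rep (⇒Δ {φ} {ψ} d e) = rep-⇒ {θ = sub proj id φ} {sub proj id ψ} (rep d) (rep e)
  rep (∃Δ {t} d)       = rep-bounded t (rep d)
  rep {n} {k} (∀Δ {t} {φ} d) = rep-equiv {θ = ¬̇ (∃₁ (α ∧̇ ¬̇ β))} {η = ∀₁ (α ⇒̇ β)}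
    ¬∃¬⇒∀ ∀⇒¬∃¬
    (rep-¬ {θ = ∃₁ (α ∧̇ ¬̇ β)} (rep-bounded t (rep-¬ {θ = sub proj id φ} (rep d))))
    where
    α β : Formula 2 k
    α = v₀ <̇ tsub (lift₁ proj) (twk t)
    β = sub (lift₁ proj) id φ

  -- Comprehension and induction

  pack : (Fin n → Term m) → Term m
  pack {zero}  σ = O
  pack {suc n} σ = ⟨ σ zero , pack (σ ∘ suc) ⟩

  proj-pack : ∀ {Γ : List (Formula m k)} (σ : Fin n → Term m) i →
              ΔRA₂ ∣ Γ ⊢ tsub (λ _ → pack σ) (proj i) ≐ σ i
  proj-pack σ zero    = inst H-⟨⟩ (σ zero ∷ pack (σ ∘ suc) ∷ []) []
  proj-pack σ (suc i) = ≐-trans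
    (cast (cong (_≐ tsub (λ _ → pack (σ ∘ suc)) (proj i)) (sym (tsub-tsub _ _ (proj i))))
          (tsub-≐ (λ _ → inst T-⟨⟩ (σ zero ∷ pack (σ ∘ suc) ∷ []) []) (proj i)))
    (proj-pack (σ ∘ suc) i)

  twk-pack : (σ : Fin n → Term m) → twk (pack σ) ≡ pack (twk ∘ σ)
  twk-pack {zero}  σ = refl
  twk-pack {suc n} σ = cong (λ u → ⟨ twk (σ zero) , u ⟩) (twk-pack (σ ∘ suc))

  -- With the parameter p = v₀, the set of all x with θ at the pair (x, p).
  section-exists : {θ : Formula 1 k} → Representable (pred θ) →
                      ΔRA₂ ⊢[ 1 , k ] ∃₂ (∀₁ (v₀ ∈̇ s₀ ⇔̇ sub (λ _ → ⟨ v₀ , v₁ ⟩) suc θ))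
  section-exists {k} {θ} a = ∀-open (∃₂E a (∀₁I (∃₂-map
    (⇒E (inst (∀₂-open (axiom 1 0 comprehension)) (v₀ ∷ []) (s₀ ∷ [])) (⊢wk₁ (∧E₁ x)))
    (∀₁I (⇔-trans members (cast (cong (s₁ [ ⟨ v₀ , v₁ ⟩ ]≐ 𝟏 ⇔̇_)
                                 (sub-square (λ _ → refl) (λ _ → refl) θ)) values))))))
    where
    Γ : List (Formula 0 (suc k))
    Γ = Realizes (pred θ) suc zero ∷ []
    x : ΔRA₂ ∣ Γ ⊢ Realizes (pred θ) suc zero
    x = hyp i₀
    X-def : Formula 1 (2 + k)
    X-def = ∀₁ (v₀ ∈̇ s₀ ⇔̇ s₁ [ ⟨ v₀ , v₁ ⟩ ]≐ 𝟏)
    Γ⁺ : List (Formula 1 (2 + k))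
    Γ⁺ = X-def ∷ List.map wk₂ (List.map wk₁ Γ)
    members : ΔRA₂ ∣ List.map wk₁ Γ⁺ ⊢ v₀ ∈̇ s₀ ⇔̇ s₁ [ ⟨ v₀ , v₁ ⟩ ]≐ 𝟏
    members = ∀-open {Γ = Γ⁺} (hyp i₀)
    values : ΔRA₂ ∣ List.map wk₁ Γ⁺ ⊢
             s₁ [ ⟨ v₀ , v₁ ⟩ ]≐ 𝟏 ⇔̇ sub (lift₁ var) suc (sub (λ _ → ⟨ v₀ , v₁ ⟩) suc θ)
    values = ∀-open {Γ = Γ⁺} (weaken there (⊢wk₂ {Γ = List.map wk₁ Γ} (∀₁I (on-pairs {X = s₀} x))))

  Δ⁰₀-comprehension : {φ : Formula (suc n) k} → Δ⁰₀ φ → ΔRA₂ ⊢ ∃₂ (∀₁ (v₀ ∈̇ s₀ ⇔̇ wk₂ φ))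
  Δ⁰₀-comprehension {n} {k} {φ} δ = ∃₂-map
    (cast (cong (λ ψ → ∃₂ (∀₁ (v₀ ∈̇ s₀ ⇔̇ ψ)))
            (trans (cong (sub _ _) (sub-fuse (λ _ → refl) (λ _ → refl) φ))
                   (sub-fuse {σ′ = coded} {ρ′ = suc} (λ i → tsub-tsub _ _ (proj i)) (λ _ → refl) φ)))
      (⊢-sub (λ _ → pack var) id (λ ()) (section-exists (rep δ))))
    (∀₁I (⇔-trans (∀-open {Γ = ∀₁ (v₀ ∈̇ s₀ ⇔̇ sub coded suc φ) ∷ []} (hyp i₀))
                  (leibniz-⇔ decode φ)))
    where
    coded : Fin (suc n) → Term (suc n)
    coded i = tsub (λ _ → ⟨ v₀ , twk (pack var) ⟩) (proj i)
    decode : ∀ {Δ : List (Formula (suc n) (suc k))} i → ΔRA₂ ∣ Δ ⊢ coded i ≐ var i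
    decode i = cast (cong (λ p → tsub (λ _ → ⟨ v₀ , p ⟩) (proj i) ≐ var i) (sym (twk-pack var))) (proj-pack var i)

  -- If x < y failed, then y ≤ x < S x, against S x < y.
  S<-< : ΔRA₂ ⊢[ 2 , 0 ] S v₀ <̇ v₁ ⇒̇ v₀ <̇ v₁
  S<-< = auto ( inst <-total (v₀ ∷ v₁ ∷ []) [] ◂ inst <-asym (S v₀ ∷ v₁ ∷ []) []
              ◂ inst <-S (v₁ ∷ v₀ ∷ []) [] ◂ [])

  -- Let a ∉ X, and let z be the least number up to a outside X, found by minimisation
  -- with bound S a from the characteristic function of the complement of X on pairs (y, 0).
  -- If z = 0, then X does not contain 0; if z = S y, then y is in X but S y is not.
  -- In the second case S<-< shows that y is below the bound.
  set-induction : ΔRA₂ ⊢[ 0 , 1 ] O ∈̇ s₀ ∧̇ ∀₁ (v₀ ∈̇ s₀ ⇒̇ S v₀ ∈̇ s₀) ⇒̇ ∀₁ (v₀ ∈̇ s₀)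
  set-induction = ⇒I (∃₂E (weaken (λ ()) (rep-¬ {θ = H v₀ ∈̇ s₀} (rep-∈ (H v₀) s₀)))
    (∃₂E (⇒E (inst (op₁ μᵒ) [] (s₀ ∷ [])) (auto []))
    (∀₁I (∃₁E (⇒E (inst ℱ-total (⟨ S v₀ , O ⟩ ∷ []) (s₀ ∷ [])) (auto []))
    (cases (v₀ ≐ O)
      (auto
        ( inst μ-clauses (O ∷ v₁ ∷ v₀ ∷ S v₁ ∷ []) (s₀ ∷ s₁ ∷ [])
        ◂ inst O<S (v₁ ∷ []) []
        ◂ inst H-⟨⟩ (O ∷ O ∷ []) []
        ◂ ∀₁E (∧E₂ (hyp i₃)) ⟨ O , O ⟩
        ◂ inst ℱ-unique (⟨ O , O ⟩ ∷ 𝟏 ∷ O ∷ []) (s₁ ∷ [])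
        ◂ inst S≢0 (O ∷ []) [] ◂ []))
      (∃₁E (⇒E (inst (axiom 1 0 (basic pred)) (v₀ ∷ []) [])
               (auto (inst <-total (O ∷ v₀ ∷ []) [] ◂ inst ≮O (v₀ ∷ []) [] ◂ [])))
      (auto
        ( inst μ-clauses (O ∷ v₂ ∷ v₁ ∷ S v₂ ∷ []) (s₀ ∷ s₁ ∷ [])
        ◂ inst μ-clauses (O ∷ v₀ ∷ v₁ ∷ S v₂ ∷ []) (s₀ ∷ s₁ ∷ [])
        ◂ ∀₁E (∧E₂ (hyp i₅)) v₀
        ◂ ∀₁E (∧E₂ (hyp i₄)) ⟨ v₀ , O ⟩
        ◂ ∀₁E (∧E₂ (hyp i₄)) ⟨ v₁ , O ⟩
        ◂ ∀₁E (∧E₂ (hyp i₄)) ⟨ v₂ , O ⟩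
        ◂ inst H-⟨⟩ (v₀ ∷ O ∷ []) [] ◂ inst H-⟨⟩ (v₁ ∷ O ∷ []) [] ◂ inst H-⟨⟩ (v₂ ∷ O ∷ []) []
        ◂ inst ℱ-unique (⟨ v₁ , O ⟩ ∷ 𝟏 ∷ O ∷ []) (s₁ ∷ [])
        ◂ inst S≢0 (O ∷ []) []
        ◂ inst <-S (v₂ ∷ v₂ ∷ []) [] ◂ inst <-S (v₁ ∷ v₂ ∷ []) []
        ◂ inst S<-< (v₀ ∷ S v₂ ∷ []) []
        ◂ inst <-asym (v₀ ∷ v₁ ∷ []) [] ◂ []))))))))

  RCA₀⁻-axiom : ∀ {ψ} → RCA₀⁻ ψ → ΔRA₂ ⊢ ψ
  RCA₀⁻-axiom (basic b)                 = axiom 0 0 (basic b)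
  RCA₀⁻-axiom induction                 = close-⊢ 0 1 set-induction
  RCA₀⁻-axiom (comprehension {n} {k} δ) = close-⊢ n k (Δ⁰₀-comprehension δ)
  RCA₀⁻-axiom composition               = axiom 0 0 (operator ∘ᵒ)

corollary9p7 : Equivalent RCA₀⁻ ΔRA₂
corollary9p7 φ = mk⇔ (⊢-theory InΔRA₂.RCA₀⁻-axiom) (⊢-theory InRCA₀⁻.ΔRA₂-axiom)
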